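{- Let $p$ be a prime, and let $a,n\in\mathbb Z^+$ with $n\ge p^{a-1}$. (i) For any $r\in\mathbb Z$ we have $$F_{p^a}(n,r)\equiv\sum_{k=0}^{d}\binom{r+k-1}{k}F_{p^a}(n+k,0)\pmod p,$$ where $d=\{p^{a-1}-1-n\}_{\varphi(p^a)}$ is the least nonnegative integer with $n+d\equiv p^{a-1}-1\pmod{\varphi(p^a)}$. (ii) We have $$\mathrm{ord}_p\bigl(C_{p^a}(n,r)\bigr)=\left\lfloor\frac{n-p^{a-1}}{\varphi(p^a)}\right\rfloor\quad(\text{i.e., } p\nmid F_{p^a}(n,r))\quad\text{for some } r\in\mathbb Z.$$ If $n\ge 2p^{a-1}$, then $$F_{p^a}\bigl(n+p^a(p-1),r\bigr)\equiv F_{p^a}(n,r)\pmod p\quad\text{for all } r\in\mathbb Z.$$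
   Context: $\mathbb Z^+=\{1,2,\ldots\}$, $\mathbb N=\{0,1,2,\ldots\}$. For $b\in\mathbb Z$ and a positive integer $m$, $\{b\}_m$ denotes the least nonnegative residue of $b$ modulo $m$. $\varphi$ is Euler's totient function, and $\mathrm{ord}_p$ is the $p$-adic order. Binomial coefficients are generalized: $\binom{x}{k}=x(x-1)\cdots(x-k+1)/k!$ with $\binom x0=1$. For $m\in\mathbb Z^+$, $n\in\mathbb N$, $r\in\mathbb Z$, put $C_m(n,r)=\sum_{0\le k\le n,\ k\equiv r\,(\mathrm{mod}\ m)}\binom nk(-1)^k$. For a prime $p$, $a\in\mathbb Z^+$, $n\in\mathbb N$ and $r\in\mathbb Z$, the generalized Fleck quotient is $$F_{p^a}(n,r)=(-p)^{ -\lfloor(n-p^{a-1})/\varphi(p^a)\rfloor}C_{p^a}(n,r)+[\![n<p^{a-1}]\!],$$ where $[\![A]\!]$ is $1$ if the assertion $A$ holds and $0$ otherwise; it is an integer (Weisman). -}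

module Defs where

open import Data.Bool.Base using (if_then_else_)
open import Data.Fin.Base using (toℕ)
open import Data.Integer.Base as ℤ using (ℤ; +_; -[1+_]; 0ℤ; 1ℤ; -1ℤ)
open import Data.Integer.Divisibility.Signed as ℤ using (_∣_; _∣?_)
open import Data.List.Base using (filter; length; map; upTo)
open import Data.List.Membership.Propositional using (lose)
open import Data.List.Membership.Propositional.Properties using (∈-map⁺; ∈-upTo⁺)
open import Data.List.Properties using (filter-some)
open import Data.Nat.Base as ℕ using (ℕ; zero; suc; NonZero; >-nonZero; >-nonZero⁻¹; _!)
open import Data.Nat.Combinatorics using (_C_)
open import Data.Nat.Coprimality using (coprime?; 1-coprimeTo)
open import Data.Nat.Properties using (_!≢0; _<?_; m^n≢0)
open import Data.Product.Base using (∃-syntax; _×_)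
open import Data.Rational.Base as ℚ using (ℚ; 0ℚ; 1ℚ)
open import Data.Rational.Properties using (normalize-pos)
open import Relation.Binary.PropositionalEquality.Core using (_≡_)
open import Relation.Nullary.Decidable.Core using (does)
open import Relation.Nullary.Negation.Core using (¬_)
import Algebra.Definitions.RawMonoid as RawMonoidDefs
import Algebra.Definitions.RawSemiring as RawSemiringDefs

open RawMonoidDefs ℤ.+-0-rawMonoid public using () renaming (sum to sumℤ)
open RawMonoidDefs ℚ.+-0-rawMonoid public using () renaming (sum to sumℚ)
open RawSemiringDefs ℚ.+-*-rawSemiring public using () renaming (_^_ to _^ℚ_)

fromℤ : ℤ → ℚ
fromℤ z = z ℚ./ 1

φ : ℕ → ℕ
φ n = length (filter (λ k → coprime? k n) (map suc (upTo n)))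

φ-nonZero : ∀ n .{{_ : NonZero n}} → NonZero (φ n)
φ-nonZero n = >-nonZero (filter-some (λ k → coprime? k n)
  (lose (∈-map⁺ suc (∈-upTo⁺ (>-nonZero⁻¹ n))) (1-coprimeTo n)))

φ[p^a]-nonZero : ∀ p a .{{_ : NonZero p}} → NonZero (φ (p ℕ.^ a))
φ[p^a]-nonZero p a = φ-nonZero (p ℕ.^ a) {{m^n≢0 p a}}

_^ℤ_ : (x : ℚ) .{{_ : ℚ.NonZero x}} → ℤ → ℚ
x ^ℤ (+ n)    = x ^ℚ n
x ^ℤ -[1+ n ] = (ℚ.1/ x) ^ℚ suc n

-- binom x k is the generalised binomial x (x - 1) ⋯ (x - k + 1) / k !.
fallingFactorial : ℤ → ℕ → ℤ
fallingFactorial x zero    = 1ℤ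
fallingFactorial x (suc k) = fallingFactorial x k ℤ.* (x ℤ.- + k)

binom : ℤ → ℕ → ℚ
binom x k = (fallingFactorial x k ℚ./ k !) {{k !≢0}}

-- C_m(n, r): the sum of (-1) ^ k * (n C k) over 0 ≤ k ≤ n with k ≡ r (mod m).
altSum : (m n : ℕ) (r : ℤ) → ℤ
altSum m n r = sumℤ {suc n} λ k →
  if does (+ m ℤ.∣? (+ toℕ k ℤ.- r))
  then + (n C toℕ k) ℤ.* -1ℤ ℤ.^ toℕ k
  else 0ℤ

-- ⌊ (n - p ^ (a - 1)) / φ (p ^ a) ⌋; ℤ._/ℕ_ rounds towards -∞.
fleckExponent : (p a n : ℕ) .{{_ : NonZero p}} → ℤ
fleckExponent p a n =
  ((+ n ℤ.- + (p ℕ.^ (a ℕ.∸ 1))) ℤ./ℕ φ (p ℕ.^ a)) {{φ[p^a]-nonZero p a}}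

-- { p ^ (a - 1) - 1 - n }_{φ (p ^ a)}, the least nonnegative residue.
fleckDegree : (p a n : ℕ) .{{_ : NonZero p}} → ℕ
fleckDegree p a n =
  ((+ (p ℕ.^ (a ℕ.∸ 1)) ℤ.- 1ℤ ℤ.- + n) ℤ.%ℕ φ (p ℕ.^ a)) {{φ[p^a]-nonZero p a}}

neg : ℕ → ℚ
neg p = ℚ.- fromℤ (+ p)

neg-nonZero : ∀ p .{{_ : NonZero p}} → ℚ.NonZero (neg p)
neg-nonZero p with ℚ.normalize p 1 | normalize-pos p 1
... | ℚ.mkℚ ℤ.+[1+ _ ] _ _ | _ = _

-- F_{p^a}(n, r), meaningful for p prime and a ≥ 1. It is defined as a rational
-- number, since its integrality is a theorem rather than part of the formula.
fleckQuotient : (p a n : ℕ) (r : ℤ) .{{_ : NonZero p}} → ℚ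
fleckQuotient p a n r =
  (neg p ^ℤ (ℤ.- fleckExponent p a n)) ℚ.* fromℤ (altSum (p ℕ.^ a) n r)
  ℚ.+ (if does (n <? p ℕ.^ (a ℕ.∸ 1)) then 1ℚ else 0ℚ)
  where instance _ = neg-nonZero p

-- Congruence and non-divisibility are those of ℤ: for rational arguments both
-- include the claim that the arguments are integers.
infix 4 _≡_[mod_]

_≡_[mod_] : ℚ → ℚ → ℕ → Set
x ≡ y [mod m ] = ∃[ u ] ∃[ v ]
  x ≡ fromℤ u × y ≡ fromℤ v × + m ℤ.∣ (u ℤ.- v)

infix 4 _∤ℚ_

_∤ℚ_ : ℕ → ℚ → Set
m ∤ℚ x = ∃[ u ] x ≡ fromℤ u × ¬ (+ m ℤ.∣ u)

-- IsOrd p z e says ord_p z = e: the largest k with p ^ k ∣ z exists and is e.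
-- Since ord_p 0 = ∞, it holds for no e when z = 0.
IsOrd : ℕ → ℤ → ℤ → Set
IsOrd p z e = ∃[ k ]
  e ≡ + k × + (p ℕ.^ k) ℤ.∣ z × (∀ j → + (p ℕ.^ j) ℤ.∣ z → j ℕ.≤ k)

{-# OPTIONS --safe #-}

-- Let y = 1 - x in ℤ[x]/(x^N - 1) with N = p^a, so that C_N(n, r) is the coefficient of x^r
-- in y^n. Put q = p^(a-1), ϕ = φ(N) = q (p - 1), Y = y^q and Z = 1 - x^q. The Frobenius
-- congruence gives Y = Z + p g, and (x^q)^p = 1 gives Z^p = - p Z (1 - Z t); hence
-- Z y^ϕ = - p ε Z for some ε. Therefore y^(q + e ϕ) = (- p)^e M_e, where M_0 = Y and
-- M_(e+1) = Z ε^(e+1) + B M_e with B = - Y^(p-2) g, and for s < ϕ the Fleck quotient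
-- F(q + s + e ϕ, r) is the coefficient of x^r in y^s M_e.
--
-- Modulo p we have Y^p = 0, Y B² = 0 and ε = 1 - Y t - B. This yields
-- M_(e+1) = Y (1 - Y t) ε^e and Y ε^p = Y, hence the periodicity in e. It also shows that
-- some multiple of y^s M_e is y^(N-1), whose constant coefficient is 1, so that y^s M_e is
-- nonzero modulo p. Finally y^ϕ M_e = 0 modulo p, so Newton's backward difference formula for
-- r ↦ F(n, r) stops after d + 1 terms, which is (i).

module Submission where

open import Defs
open import Algebra.Bundles using (CommutativeRing)
import Algebra.Properties.AbelianGroup as AbelianGroup
import Algebra.Properties.CommutativeSemiring.Binomial as Binomial
import Algebra.Properties.CommutativeSemiring.Exp as CommutativeExp
import Algebra.Properties.Monoid.Sum as MonoidSum
import Algebra.Properties.Semiring.Exp as Exp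
import Algebra.Properties.Semiring.Mult as Mult
import Algebra.Properties.Semiring.Sum as Sum
import Algebra.Solver.Ring
open import Algebra.Solver.Ring.AlmostCommutativeRing using (fromCommutativeRing; _-Raw-AlmostCommutative⟶_)
open import Data.Bool.Base using (if_then_else_; true; false)
open import Data.Fin.Base as Fin using (Fin; toℕ; fromℕ; inject₁)
open import Data.Fin.Properties using (toℕ-fromℕ; toℕ-inject₁; toℕ<n)
open import Data.Integer.Base as ℤ using (ℤ; +_; -[1+_]; 0ℤ; 1ℤ; -1ℤ)
open import Data.Integer.Divisibility.Signed as ℤ using (_∣_; _∣?_; divides)
import Data.Integer.Properties as ℤ
open import Data.Integer.Tactic.RingSolver using (solve-∀)
open import Data.List.Base using (_++_; [_]; length; map; filter; upTo; applyUpTo)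
open import Data.List.Properties using (filter-≐; filter-++; filter-accept; filter-reject; length-++; applyUpTo-∷ʳ; map-applyUpTo)
import Data.Maybe.Base as Maybe
open import Data.Nat.Base as ℕ using (ℕ; zero; suc; _!; NonZero; _+_; _*_; _∸_; _^_; _≥_)
open import Data.Nat.Combinatorics using (_C_; nC1≡n; nCn≡1; nCk+nC[k+1]≡[n+1]C[k+1])
open import Data.Nat.Coprimality as Coprimality using (Coprime; coprime?; coprime-divisor)
import Data.Nat.DivMod as ℕ
import Data.Nat.Divisibility as ℕ
open import Data.Nat.Primality using (Prime; euclidsLemma; prime⇒nonTrivial; prime⇒irreducible; ¬prime[0]; ¬prime[1])
import Data.Nat.Properties as ℕ
open import Data.Nat.Tactic.RingSolver using () renaming (solve-∀ to ℕ-solve-∀)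
open import Data.Product.Base using (∃-syntax; _×_; _,_; proj₁; proj₂)
open import Data.Rational.Base as ℚ using (ℚ; 0ℚ; 1ℚ)
import Data.Rational.Properties as ℚ
import Data.Rational.Unnormalised.Base as ℚᵘ
open import Data.Sum.Base using (inj₁; inj₂)
open import Function.Base using (id; _∘_)
open import Function.Bundles using (mk⇔)
open import Level using (0ℓ)
open import Relation.Binary.Consequences using (dec⇒weaklyDec)
open import Relation.Binary.PropositionalEquality using (_≡_; _≗_; refl; sym; trans; cong; cong₂; subst; module ≡-Reasoning)
import Relation.Binary.Reasoning.Setoid as ≈-Reasoning
open import Relation.Nullary using (¬_; contradiction; yes; no)
open import Relation.Nullary.Decidable using (¬?; does-⇔; dec-false; dec-true)
open import Relation.Nullary.Decidable.Core using (does)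

-- Integrality of the quotients requires division by powers of p, which the ring modulo p does not
-- permit. So the relations that are later divided are proved in `Quotient N 0` with explicit
-- remainders `g`, `t`, `κ`, and only the quotients are reduced modulo p. Y and Z have the same
-- residue modulo p but different roles: Y is the power of y under study, while Z satisfies the
-- closed relation, inherited from (x^q)^p = 1, that yields a factor p. Thus a factor y^ϕ turns into
-- - p ε only in the presence of Z. Replacing Y by Z costs p g; this error is itself divisible by p,
-- and B carries it along the recursion. Modulo p, ε acts as a unit on the multiples of Y, so its
-- powers can be undone there; this drives both the periodicity and the nonvanishing. The initial
-- value M_0 = Y does not follow the formula for M_(e+1), and this exception is where the bound n ≥
-- 2 q comes from.

private
  module ∑ℤ = Sum ℤ.+-*-semiring
  module ∑ℚ = MonoidSum ℚ.+-0-monoid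
  open AbelianGroup ℤ.+-0-abelianGroup using () renaming (∙-cancelʳ to ℤ-+-cancelʳ)

-- Binomial coefficients and φ (p ^ a)

[1+k]*[1+n]C[1+k]≡[1+n]*nCk : ∀ n k → suc k * (suc n C suc k) ≡ suc n * (n C k)
[1+k]*[1+n]C[1+k]≡[1+n]*nCk zero zero = refl
[1+k]*[1+n]C[1+k]≡[1+n]*nCk zero (suc k) = ℕ.*-zeroʳ (2 + k)
[1+k]*[1+n]C[1+k]≡[1+n]*nCk (suc n) zero =
  trans (ℕ.*-identityˡ ((2 + n) C 1)) (trans (nC1≡n (2 + n)) (sym (ℕ.*-identityʳ (2 + n))))
[1+k]*[1+n]C[1+k]≡[1+n]*nCk (suc n) (suc k) = begin
  (2 + k) * ((2 + n) C (2 + k))                                 ≡⟨ cong ((2 + k) *_) (nCk+nC[k+1]≡[n+1]C[k+1] (suc n) (suc k)) ⟨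
  (2 + k) * ((suc n C suc k) + (suc n C (2 + k)))             ≡⟨ expand k (suc n C suc k) (suc n C (2 + k)) ⟩
  (suc n C suc k) + (suc k * (suc n C suc k) + (2 + k) * (suc n C (2 + k)))
    ≡⟨ cong (λ c → (suc n C suc k) + c) (cong₂ _+_ ([1+k]*[1+n]C[1+k]≡[1+n]*nCk n k) ([1+k]*[1+n]C[1+k]≡[1+n]*nCk n (suc k))) ⟩
  (suc n C suc k) + (suc n * (n C k) + suc n * (n C suc k)) ≡⟨ cong (λ c → (suc n C suc k) + c) (ℕ.*-distribˡ-+ (suc n) (n C k) (n C suc k)) ⟨
  (suc n C suc k) + suc n * ((n C k) + (n C suc k))         ≡⟨ cong (λ c → (suc n C suc k) + suc n * c) (nCk+nC[k+1]≡[n+1]C[k+1] n k) ⟩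
  (2 + n) * (suc n C suc k) ∎
  where
  open ≡-Reasoning
  expand : ∀ k c d → (2 + k) * (c + d) ≡ c + (suc k * c + (2 + k) * d)
  expand = ℕ-solve-∀

prime⇒p∣pCk : ∀ {p} → Prime p → ∀ k → suc k ℕ.< p → p ℕ.∣ (p C suc k)
prime⇒p∣pCk {p@(suc n)} pp k k<p
  with euclidsLemma (suc k) (p C suc k) pp
         (subst (p ℕ.∣_) (sym ([1+k]*[1+n]C[1+k]≡[1+n]*nCk n k)) (ℕ.m∣m*n (n C k)))
... | inj₁ p∣k = contradiction p∣k (ℕ.>⇒∤ k<p)
... | inj₂ p∣C = p∣C

1<prime : ∀ {p} → Prime p → 1 ℕ.< p
1<prime pp = ℕ.nonTrivial⇒n>1 _ {{prime⇒nonTrivial pp}}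

prime∤⇒coprime-^ : ∀ {p} → Prime p → ∀ a {k} → ¬ p ℕ.∣ k → Coprime k (p ^ a)
prime∤⇒coprime-^ pp zero p∤k (_ , d∣1) = ℕ.∣1⇒≡1 d∣1
prime∤⇒coprime-^ {p} pp (suc a) {k} p∤k (d∣k , d∣p*pᵃ) =
  prime∤⇒coprime-^ pp a p∤k (d∣k , coprime-divisor d⊥p d∣p*pᵃ)
  where
  d⊥p : Coprime _ p
  d⊥p (i∣d , i∣p) with prime⇒irreducible pp i∣p
  ... | inj₁ i≡1 = i≡1
  ... | inj₂ refl = contradiction (ℕ.∣-trans i∣d d∣k) p∤k

coprime-^⇒prime∤ : ∀ {p} → Prime p → ∀ a {k} → Coprime k (p ^ suc a) → ¬ p ℕ.∣ k
coprime-^⇒prime∤ {p} pp a k⊥pᵃ p∣k =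
  contradiction (k⊥pᵃ (p∣k , ℕ.m∣m*n (p ^ a))) (ℕ.>⇒≢ (1<prime pp))

module _ (p : ℕ) .{{_ : NonZero p}} where

  nonMultiples≤ : ℕ → ℕ
  nonMultiples≤ n = length (filter (λ k → ¬? (p ℕ.∣? k)) (applyUpTo suc n))

  nonMultiples≤-suc : ∀ n → nonMultiples≤ (suc n) ≡
    nonMultiples≤ n + length (filter (λ k → ¬? (p ℕ.∣? k)) [ suc n ])
  nonMultiples≤-suc n = begin
    length (filter P? (applyUpTo suc (suc n)))                  ≡⟨ cong (length ∘ filter P?) (applyUpTo-∷ʳ suc n) ⟨
    length (filter P? (applyUpTo suc n ++ [ suc n ]))           ≡⟨ cong length (filter-++ P? (applyUpTo suc n) [ suc n ]) ⟩
    length (filter P? (applyUpTo suc n) ++ filter P? [ suc n ]) ≡⟨ length-++ (filter P? (applyUpTo suc n)) ⟩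
    nonMultiples≤ n + length (filter P? [ suc n ]) ∎
    where
    open ≡-Reasoning
    P? = λ k → ¬? (p ℕ.∣? k)

  nonMultiples≤-∤ : ∀ n → ¬ p ℕ.∣ suc n → nonMultiples≤ (suc n) ≡ suc (nonMultiples≤ n)
  nonMultiples≤-∤ n p∤ = trans (nonMultiples≤-suc n)
    (trans (cong (λ l → nonMultiples≤ n + length l) (filter-accept (λ k → ¬? (p ℕ.∣? k)) p∤))
           (ℕ.+-comm _ 1))

  nonMultiples≤-∣ : ∀ n → p ℕ.∣ suc n → nonMultiples≤ (suc n) ≡ nonMultiples≤ n
  nonMultiples≤-∣ n p∣ = trans (nonMultiples≤-suc n)
    (trans (cong (λ l → nonMultiples≤ n + length l) (filter-reject (λ k → ¬? (p ℕ.∣? k)) (λ p∤ → p∤ p∣)))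
           (ℕ.+-identityʳ _))

  nonMultiples≤-+ : ∀ q j → j ℕ.< p → nonMultiples≤ (j + q * p) ≡ j + nonMultiples≤ (q * p)
  nonMultiples≤-+ q zero    _   = refl
  nonMultiples≤-+ q (suc j) j<p =
    trans (nonMultiples≤-∤ (j + q * p) (λ p∣ → ℕ.>⇒∤ j<p (∣m+n∣n⇒∣m p∣ (ℕ.n∣m*n q))))
          (cong suc (nonMultiples≤-+ q j (ℕ.<-trans (ℕ.n<1+n j) j<p)))
    where
    ∣m+n∣n⇒∣m : ∀ {m n} → p ℕ.∣ m + n → p ℕ.∣ n → p ℕ.∣ m
    ∣m+n∣n⇒∣m {m} {n} p∣m+n p∣n = ℕ.∣m+n∣m⇒∣n (subst (p ℕ.∣_) (ℕ.+-comm m n) p∣m+n) p∣n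

  nonMultiples≤-* : ∀ q → nonMultiples≤ (q * p) ≡ q * (p ∸ 1)
  nonMultiples≤-* zero    = refl
  nonMultiples≤-* (suc q) = begin
    nonMultiples≤ (p + q * p)           ≡⟨ cong (λ m → nonMultiples≤ (m + q * p)) (ℕ.suc-pred p) ⟨
    nonMultiples≤ (suc (ℕ.pred p + q * p)) ≡⟨ nonMultiples≤-∣ (ℕ.pred p + q * p) (subst (λ m → p ℕ.∣ m + q * p) (sym (ℕ.suc-pred p)) (ℕ.n∣m*n (suc q))) ⟩
    nonMultiples≤ (ℕ.pred p + q * p)      ≡⟨ nonMultiples≤-+ q (ℕ.pred p) (pred[n]<n {p}) ⟩
    ℕ.pred p + nonMultiples≤ (q * p)      ≡⟨ cong (λ m → ℕ.pred p + m) (nonMultiples≤-* q) ⟩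
    (p ∸ 1) + q * (p ∸ 1) ∎
    where
    open ≡-Reasoning
    pred[n]<n : ∀ {n} .{{_ : NonZero n}} → ℕ.pred n ℕ.< n
    pred[n]<n {suc n} = ℕ.n<1+n n

-- For a positive exponent, being coprime to the prime power only means not being a multiple of p,
-- and each of the p ^ a blocks of p consecutive numbers contains p - 1 non-multiples.
φ[p^[1+a]]≡p^a*[p-1] : ∀ p .{{_ : NonZero p}} → Prime p → ∀ a → φ (p ^ suc a) ≡ p ^ a * (p ∸ 1)
φ[p^[1+a]]≡p^a*[p-1] p pp a = begin
  length (filter (λ k → coprime? k (p ^ suc a)) (map suc (upTo (p ^ suc a))))
    ≡⟨ cong length (filter-≐ (λ k → coprime? k (p ^ suc a)) (λ k → ¬? (p ℕ.∣? k)) ((λ {k} → coprime-^⇒prime∤ pp a {k}) , (λ {k} → prime∤⇒coprime-^ pp (suc a) {k})) (map suc (upTo (p ^ suc a)))) ⟩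
  length (filter (λ k → ¬? (p ℕ.∣? k)) (map suc (upTo (p ^ suc a))))
    ≡⟨ cong (length ∘ filter (λ k → ¬? (p ℕ.∣? k))) (map-applyUpTo id suc (p ^ suc a)) ⟩
  nonMultiples≤ p (p * p ^ a) ≡⟨ cong (nonMultiples≤ p) (ℕ.*-comm p (p ^ a)) ⟩
  nonMultiples≤ p (p ^ a * p) ≡⟨ nonMultiples≤-* p (p ^ a) ⟩
  p ^ a * (p ∸ 1) ∎
  where open ≡-Reasoning

-- The ring ℤ[x]/(x^N - 1, m)

infixl 6 _⊕_
infixl 7 _⊗_
infix  8 ⊖_

-- Polynomials in x, represented by the operators they induce on functions ℤ → ℤ with x acting as
-- a shift; two expressions are identified only through their action.
data Op : Set where
  con     : ℤ → Op
  x       : Op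
  _⊕_ _⊗_ : Op → Op → Op

⊖_ : Op → Op
⊖ u = con -1ℤ ⊗ u

act : Op → (ℤ → ℤ) → ℤ → ℤ
act (con k) f r = k ℤ.* f r
act x       f r = f (r ℤ.- 1ℤ)
act (u ⊕ v) f r = act u f r ℤ.+ act v f r
act (u ⊗ v) f   = act u (act v f)

infix 4 _≡_⟨_⟩
_≡_⟨_⟩ : ℤ → ℤ → ℕ → Set
i ≡ j ⟨ m ⟩ = + m ∣ i ℤ.- j

module _ {m : ℕ} where
  ⟨⟩-reflexive : ∀ {i j} → i ≡ j → i ≡ j ⟨ m ⟩
  ⟨⟩-reflexive {i} refl = divides 0ℤ (trans (ℤ.+-inverseʳ i) (sym (ℤ.*-zeroˡ (+ m))))

  ⟨⟩-sym : ∀ {i j} → i ≡ j ⟨ m ⟩ → j ≡ i ⟨ m ⟩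
  ⟨⟩-sym {i} {j} d = subst (+ m ∣_) (eq i j) (ℤ.∣m⇒∣-m d)
    where
    eq : ∀ i j → ℤ.- (i ℤ.- j) ≡ j ℤ.- i
    eq = solve-∀

  ⟨⟩-trans : ∀ {i j k} → i ≡ j ⟨ m ⟩ → j ≡ k ⟨ m ⟩ → i ≡ k ⟨ m ⟩
  ⟨⟩-trans {i} {j} {k} d e = subst (+ m ∣_) (eq i j k) (ℤ.∣m∣n⇒∣m+n d e)
    where
    eq : ∀ i j k → (i ℤ.- j) ℤ.+ (j ℤ.- k) ≡ i ℤ.- k
    eq = solve-∀

  ⟨⟩-+ : ∀ {i j k l} → i ≡ j ⟨ m ⟩ → k ≡ l ⟨ m ⟩ → i ℤ.+ k ≡ j ℤ.+ l ⟨ m ⟩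
  ⟨⟩-+ {i} {j} {k} {l} d e = subst (+ m ∣_) (eq i j k l) (ℤ.∣m∣n⇒∣m+n d e)
    where
    eq : ∀ i j k l → (i ℤ.- j) ℤ.+ (k ℤ.- l) ≡ (i ℤ.+ k) ℤ.- (j ℤ.+ l)
    eq = solve-∀

  ⟨⟩-* : ∀ k {i j} → i ≡ j ⟨ m ⟩ → k ℤ.* i ≡ k ℤ.* j ⟨ m ⟩
  ⟨⟩-* k {i} {j} d = subst (+ m ∣_) (eq k i j) (ℤ.∣n⇒∣m*n k d)
    where
    eq : ∀ k i j → k ℤ.* (i ℤ.- j) ≡ k ℤ.* i ℤ.- k ℤ.* j
    eq = solve-∀

  act-cong : ∀ u {f g} → (∀ r → f r ≡ g r ⟨ m ⟩) → ∀ r → act u f r ≡ act u g r ⟨ m ⟩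
  act-cong (con k) f≈g r = ⟨⟩-* k (f≈g r)
  act-cong x       f≈g r = f≈g (r ℤ.- 1ℤ)
  act-cong (u ⊕ v) f≈g r = ⟨⟩-+ {act u _ r} (act-cong u f≈g r) (act-cong v f≈g r)
  act-cong (u ⊗ v) f≈g   = act-cong u (act-cong v f≈g)

≡⟨0⟩⇒≡ : ∀ {i j} → i ≡ j ⟨ 0 ⟩ → i ≡ j
≡⟨0⟩⇒≡ {i} {j} d = ℤ.i-j≡0⇒i≡j i j (ℤ.0∣⇒≡0 d)

act-cong-≗ : ∀ u {f g : ℤ → ℤ} → f ≗ g → act u f ≗ act u g
act-cong-≗ u f≗g r = ≡⟨0⟩⇒≡ (act-cong u (λ s → ⟨⟩-reflexive (f≗g s)) r)

act-+ : ∀ u f g r → act u (λ s → f s ℤ.+ g s) r ≡ act u f r ℤ.+ act u g r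
act-+ (con k) f g r = ℤ.*-distribˡ-+ k (f r) (g r)
act-+ x       f g r = refl
act-+ (u ⊕ v) f g r = trans (cong₂ ℤ._+_ (act-+ u f g r) (act-+ v f g r))
  (swap (act u f r) (act u g r) (act v f r) (act v g r))
  where
  swap : ∀ a b c d → (a ℤ.+ b) ℤ.+ (c ℤ.+ d) ≡ (a ℤ.+ c) ℤ.+ (b ℤ.+ d)
  swap = solve-∀
act-+ (u ⊗ v) f g r = trans (act-cong-≗ u (act-+ v f g) r) (act-+ u (act v f) (act v g) r)

act-* : ∀ u k f r → act u (λ s → k ℤ.* f s) r ≡ k ℤ.* act u f r
act-* (con l) k f r = swap l k (f r)
  where
  swap : ∀ l k i → l ℤ.* (k ℤ.* i) ≡ k ℤ.* (l ℤ.* i)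
  swap = solve-∀
act-* x       k f r = refl
act-* (u ⊕ v) k f r = trans (cong₂ ℤ._+_ (act-* u k f r) (act-* v k f r)) (sym (ℤ.*-distribˡ-+ k (act u f r) (act v f r)))
act-* (u ⊗ v) k f r = trans (act-cong-≗ u (act-* v k f) r) (act-* u k (act v f) r)

act-comm-x : ∀ u f r → act u (λ s → f (s ℤ.- 1ℤ)) r ≡ act u f (r ℤ.- 1ℤ)
act-comm-x (con k) f r = refl
act-comm-x x       f r = refl
act-comm-x (u ⊕ v) f r = cong₂ ℤ._+_ (act-comm-x u f r) (act-comm-x v f r)
act-comm-x (u ⊗ v) f r = trans (act-cong-≗ u (act-comm-x v f) r) (act-comm-x u (act v f) r)

-- Every `act v` is ℤ-linear and commutes with the shift, which settles the generators `con` and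
-- `x`; sums and products follow.
act-comm : ∀ u v f r → act u (act v f) r ≡ act v (act u f) r
act-comm (con k) v f r = sym (act-* v k f r)
act-comm x       v f r = sym (act-comm-x v f r)
act-comm (u ⊕ w) v f r = trans (cong₂ ℤ._+_ (act-comm u v f r) (act-comm w v f r)) (sym (act-+ v (act u f) (act w f) r))
act-comm (u ⊗ w) v f r = trans (act-cong-≗ u (act-comm w v f) r) (act-comm u v (act w f) r)

-- The values of `act u f` are integer combinations of values of `f`. Hence an element with a
-- multiple that is nonzero modulo m is itself nonzero modulo m.
act-nonzero : ∀ m u f r → ¬ (+ m ∣ act u f r) → ∃[ s ] ¬ (+ m ∣ f s)
act-nonzero m (con k) f r ≢0 = r , λ ≡0 → ≢0 (ℤ.∣n⇒∣m*n k ≡0)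
act-nonzero m x       f r ≢0 = r ℤ.- 1ℤ , ≢0
act-nonzero m (u ⊕ v) f r ≢0 with + m ∣? act u f r
... | no  u≢0 = act-nonzero m u f r u≢0
... | yes u≡0 = act-nonzero m v f r (λ v≡0 → ≢0 (ℤ.∣m∣n⇒∣m+n u≡0 v≡0))
act-nonzero m (u ⊗ v) f r ≢0 with act-nonzero m u (act v f) r ≢0
... | s , ≢0′ = act-nonzero m v f s ≢0′

-- The coefficients of the constant 1 modulo x^N - 1, as a periodic function of the exponent.
δ : ℕ → ℤ → ℤ
δ N r = if does (+ N ∣? r) then 1ℤ else 0ℤ

-- The coefficients of u modulo x^N - 1 are the values of act u (δ N). For m = 0 the congruence
-- is equality, so Quotient N 0 is ℤ[x]/(x^N - 1).
module Quotient (N m : ℕ) where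

  infix 4 _≈_
  -- A record rather than a bare function type: `act` unfolds, so `u` and `v` could not be recovered
  -- from the type by unification.
  record _≈_ (u v : Op) : Set where
    constructor mk≈
    field at : ∀ r → act u (δ N) r ≡ act v (δ N) r ⟨ m ⟩
  open _≈_ public

  ≗⇒≈ : ∀ {u v} → act u (δ N) ≗ act v (δ N) → u ≈ v
  ≗⇒≈ u≗v = mk≈ λ r → ⟨⟩-reflexive (u≗v r)

  private
    refl≈ : ∀ {u} → u ≈ u
    refl≈ = ≗⇒≈ λ _ → refl

    trans≈ : ∀ {u v w} → u ≈ v → v ≈ w → u ≈ w
    trans≈ {u} p q = mk≈ λ r → ⟨⟩-trans {i = act u (δ N) r} (at p r) (at q r)

    ⊗-comm : ∀ u v → u ⊗ v ≈ v ⊗ u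
    ⊗-comm u v = ≗⇒≈ (act-comm u v (δ N))

    ⊗-congˡ : ∀ w {u v} → u ≈ v → w ⊗ u ≈ w ⊗ v
    ⊗-congˡ w u≈v = mk≈ (act-cong w (at u≈v))

    -- Congruence of `act` only handles the right factor; commutativity moves the left factor there
    -- and back.
    ⊗-cong : ∀ {u v w z} → u ≈ v → w ≈ z → u ⊗ w ≈ v ⊗ z
    ⊗-cong {u} {v} {w} {z} u≈v w≈z = trans≈ (⊗-congˡ u w≈z)
      (trans≈ (⊗-comm u z) (trans≈ (⊗-congˡ z u≈v) (⊗-comm z v)))

  commutativeRing : CommutativeRing 0ℓ 0ℓ
  commutativeRing = record
    { Carrier = Op ; _≈_ = _≈_ ; _+_ = _⊕_ ; _*_ = _⊗_ ; -_ = ⊖_ ; 0# = con 0ℤ ; 1# = con 1ℤ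
    ; isCommutativeRing = record
      { isRing = record
        { +-isAbelianGroup = record
          { isGroup = record
            { isMonoid = record
              { isSemigroup = record
                { isMagma = record
                  { isEquivalence = record
                    { refl = refl≈
                    ; sym = λ {u} p → mk≈ λ r → ⟨⟩-sym {i = act u (δ N) r} (at p r)
                    ; trans = trans≈ }
                  ; ∙-cong = λ {u} p q → mk≈ λ r → ⟨⟩-+ {i = act u (δ N) r} (at p r) (at q r) }
                ; assoc = λ u v w → ≗⇒≈ λ r → ℤ.+-assoc (act u (δ N) r) _ _ }
              ; identity = (λ u → ≗⇒≈ λ r → ℤ.+-identityˡ (act u (δ N) r))
                         , (λ u → ≗⇒≈ λ r → ℤ.+-identityʳ (act u (δ N) r)) }
            ; inverse = (λ u → ≗⇒≈ λ r → inverseˡ (act u (δ N) r))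
                      , (λ u → ≗⇒≈ λ r → inverseʳ (act u (δ N) r))
            ; ⁻¹-cong = ⊗-congˡ (con -1ℤ) }
          ; comm = λ u v → ≗⇒≈ λ r → ℤ.+-comm (act u (δ N) r) _ }
        ; *-cong = ⊗-cong
        ; *-assoc = λ u v w → ≗⇒≈ λ _ → refl
        ; *-identity = (λ u → ≗⇒≈ λ r → ℤ.*-identityˡ (act u (δ N) r))
                     , (λ u → trans≈ (⊗-comm u (con 1ℤ)) (≗⇒≈ λ r → ℤ.*-identityˡ (act u (δ N) r)))
        ; distrib = (λ u v w → ≗⇒≈ (act-+ u (act v (δ N)) (act w (δ N))))
                  , (λ u v w → ≗⇒≈ λ _ → refl) }
      ; *-comm = ⊗-comm } }
    where
    inverseˡ : ∀ i → -1ℤ ℤ.* i ℤ.+ i ≡ 0ℤ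
    inverseˡ = solve-∀
    inverseʳ : ∀ i → i ℤ.+ -1ℤ ℤ.* i ≡ 0ℤ
    inverseʳ = solve-∀

  open CommutativeRing commutativeRing public
    using (setoid; +-congˡ; +-congʳ; +-cong; *-cong; *-congˡ; *-congʳ; -‿cong; semiring; commutativeSemiring)
    renaming (refl to ≈-refl; sym to ≈-sym; trans to ≈-trans; reflexive to ≈-reflexive)

  private
    con-homo : ℤ.+-*-rawRing -Raw-AlmostCommutative⟶ fromCommutativeRing commutativeRing
    con-homo = record
      { ⟦_⟧ = con
      ; +-homo = λ i j → ≗⇒≈ λ r → ℤ.*-distribʳ-+ (δ N r) i j
      ; *-homo = λ i j → ≗⇒≈ λ r → ℤ.*-assoc i j (δ N r)
      ; -‿homo = λ i → ≗⇒≈ λ r → neg-homo i (δ N r)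
      ; 0-homo = refl≈
      ; 1-homo = refl≈ }
      where
      neg-homo : ∀ i j → ℤ.- i ℤ.* j ≡ -1ℤ ℤ.* (i ℤ.* j)
      neg-homo = solve-∀

  module Solver = Algebra.Solver.Ring ℤ.+-*-rawRing (fromCommutativeRing commutativeRing) con-homo
    (λ i j → Maybe.map (λ i≡j → ≈-reflexive (cong con i≡j)) (dec⇒weaklyDec ℤ._≟_ i j))

-- The library's power takes the ring as a parameter, so powers in rings with different moduli
-- would not be definitionally equal.
infixr 9 _↑_
_↑_ : Op → ℕ → Op
u ↑ zero  = con 1ℤ
u ↑ suc n = u ⊗ u ↑ n

-- Powers and binomial expansions in the quotient rings

module Powers (N m : ℕ) where
  open Quotient N m
  open Solver renaming (con to :con) using (solve; _:=_; _:+_; _:*_; :-_; _:-_)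
  private
    module E = Exp semiring
    module M = Mult semiring
    module S = Sum semiring
    module B = Binomial commutativeSemiring

  ↑≈^ : ∀ u n → u ↑ n ≈ u E.^ n
  ↑≈^ u zero    = ≈-refl
  ↑≈^ u (suc n) = *-congˡ (↑≈^ u n)

  ↑-cong : ∀ n {u v} → u ≈ v → u ↑ n ≈ v ↑ n
  ↑-cong zero    u≈v = ≈-refl
  ↑-cong (suc n) u≈v = *-cong u≈v (↑-cong n u≈v)

  ↑-distribˡ-+ : ∀ u m n → u ↑ (m + n) ≈ u ↑ m ⊗ u ↑ n
  ↑-distribˡ-+ u m n = ≈-trans (↑≈^ u (m + n)) (≈-trans (E.^-homo-* u m n)
    (≈-sym (*-cong (↑≈^ u m) (↑≈^ u n))))

  ↑-* : ∀ u m n → (u ↑ m) ↑ n ≈ u ↑ (m * n)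
  ↑-* u m n = ≈-trans (↑-cong n (↑≈^ u m)) (≈-trans (↑≈^ (u E.^ m) n)
    (≈-trans (E.^-assocʳ u m n) (≈-sym (↑≈^ u (m * n)))))

  ↑-distrib-⊗ : ∀ u v n → (u ⊗ v) ↑ n ≈ u ↑ n ⊗ v ↑ n
  ↑-distrib-⊗ u v n = ≈-trans (↑≈^ (u ⊗ v) n) (≈-trans (CommutativeExp.^-distrib-* commutativeSemiring u v n)
    (≈-sym (*-cong (↑≈^ u n) (↑≈^ v n))))

  1↑n≈1 : ∀ n → con 1ℤ ↑ n ≈ con 1ℤ
  1↑n≈1 zero    = ≈-refl
  1↑n≈1 (suc n) = ≈-trans (*-congˡ (1↑n≈1 n)) (solve 0 (:con 1ℤ :* :con 1ℤ := :con 1ℤ) ≈-refl)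

  ×≈⊗ : ∀ k u → k M.× u ≈ con (+ k) ⊗ u
  ×≈⊗ zero    u = solve 1 (λ u → :con 0ℤ := :con 0ℤ :* u) ≈-refl u
  ×≈⊗ (suc k) u = ≈-trans (+-congˡ (×≈⊗ k u))
    (≈-trans (solve 2 (λ u k → u :+ k :* u := (:con 1ℤ :+ k) :* u) ≈-refl u (con (+ k)))
             (*-congʳ (≗⇒≈ λ r → sym (ℤ.*-distribʳ-+ (δ N r) 1ℤ (+ k)))))

  con-* : ∀ i j → con (i ℤ.* j) ≈ con i ⊗ con j
  con-* i j = ≗⇒≈ λ r → ℤ.*-assoc i j (δ N r)

  -- The term linear in B is kept apart because the expansion is later divided by p and then needed
  -- modulo Z². The terms of degree 2 to p - 1 in B share the factor p B², since p divides their
  -- binomial coefficients.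
  [A+B]^p : ∀ n → Prime (2 + n) → ∀ A B → let p = 2 + n in
    ∃[ κ ] (A ⊕ B) ↑ p ≈ (A ↑ p ⊕ con (+ p) ⊗ (A ↑ suc n ⊗ B)) ⊕ (con (+ p) ⊗ (B ⊗ B ⊗ κ) ⊕ B ↑ p)
  [A+B]^p n pp A B = κ , (begin
    (A ⊕ B) ↑ p                   ≈⟨ ↑≈^ (A ⊕ B) p ⟩
    -- The k-th term of the expansion has the first summand to the power k, so swapping lists the
    -- terms by increasing powers of B.
    (A ⊕ B) E.^ p                 ≈⟨ E.^-congˡ p (solve 2 (λ a b → a :+ b := b :+ a) ≈-refl A B) ⟩
    (B ⊕ A) E.^ p                 ≈⟨ B.theorem p B A ⟩
    B.binomialExpansion B A p     ≈⟨ +-cong t₀ (+-cong t₁ (S.sum-init-last t₂₊)) ⟩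
    A ↑ p ⊕ (con (+ p) ⊗ (A ↑ suc n ⊗ B) ⊕ (S.sum (t₂₊ ∘ inject₁) ⊕ t₂₊ (fromℕ n)))
      ≈⟨ +-congˡ (+-congˡ (+-cong ∑≈ tₚ)) ⟩
    A ↑ p ⊕ (con (+ p) ⊗ (A ↑ suc n ⊗ B) ⊕ (con (+ p) ⊗ (B ⊗ B ⊗ κ) ⊕ B ↑ p))
      ≈⟨ solve 4 (λ a b c d → a :+ (b :+ (c :+ d)) := (a :+ b) :+ (c :+ d)) ≈-refl (A ↑ p) _ (con (+ p) ⊗ (B ⊗ B ⊗ κ)) (B ↑ p) ⟩
    (A ↑ p ⊕ con (+ p) ⊗ (A ↑ suc n ⊗ B)) ⊕ (con (+ p) ⊗ (B ⊗ B ⊗ κ) ⊕ B ↑ p) ∎)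
    where
    open ≈-Reasoning setoid
    p = 2 + n
    t₂₊ : Fin (suc n) → Op
    t₂₊ k = B.binomialTerm B A p (Fin.suc (Fin.suc k))
    c : ∀ k → k ℕ.< n → ∃[ c ] p C (2 + k) ≡ c * p
    c k k<n with prime⇒p∣pCk pp (suc k) (ℕ.s≤s (ℕ.s≤s k<n))
    ... | ℕ.divides c eq = c , eq
    κₖ : Fin n → Op
    κₖ k = con (+ proj₁ (c (toℕ k) (toℕ<n k))) ⊗ (B ↑ toℕ k ⊗ A ↑ (n ∸ toℕ k))
    κ = S.sum κₖ
    t₀ : B.binomialTerm B A p Fin.zero ≈ A ↑ p
    t₀ = ≈-trans (×≈⊗ 1 _) (≈-trans (solve 1 (λ a → :con 1ℤ :* (:con 1ℤ :* a) := a) ≈-refl _) (≈-sym (↑≈^ A p)))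
    t₁ : B.binomialTerm B A p (Fin.suc Fin.zero) ≈ con (+ p) ⊗ (A ↑ suc n ⊗ B)
    t₁ = ≈-trans (×≈⊗ (p C 1) _) (*-cong (≈-reflexive (cong (con ∘ +_) (nC1≡n p)))
      (≈-trans (solve 2 (λ b a → (b :* :con 1ℤ) :* a := a :* b) ≈-refl B _) (*-congʳ (≈-sym (↑≈^ A (suc n))))))
    tₚ : t₂₊ (fromℕ n) ≈ B ↑ p
    tₚ rewrite toℕ-fromℕ n | nCn≡1 p | ℕ.n∸n≡0 n =
      ≈-trans (×≈⊗ 1 _) (≈-trans (solve 1 (λ a → :con 1ℤ :* (a :* :con 1ℤ) := a) ≈-refl _) (≈-sym (↑≈^ B p)))
    term : ∀ k → t₂₊ (inject₁ k) ≈ con (+ p) ⊗ (B ⊗ B) ⊗ κₖ k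
    term k rewrite toℕ-inject₁ k = ≈-trans (×≈⊗ (p C (2 + toℕ k)) _)
      (≈-trans (*-cong (≈-trans (≈-reflexive (cong (con) (trans (cong +_ (proj₂ (c (toℕ k) (toℕ<n k)))) (ℤ.pos-* c′ p)))) (con-* (+ c′) (+ p)))
                       (*-cong (*-congˡ (*-congˡ (≈-sym (↑≈^ B (toℕ k))))) (≈-sym (↑≈^ A (n ∸ toℕ k)))))
        (solve 5 (λ c p b bk a → (c :* p) :* (((b :* (b :* bk))) :* a) := p :* (b :* b) :* (c :* (bk :* a))) ≈-refl
          (con (+ c′)) (con (+ p)) B (B ↑ toℕ k) (A ↑ (n ∸ toℕ k))))
      where c′ = proj₁ (c (toℕ k) (toℕ<n k))
    ∑≈ : S.sum (t₂₊ ∘ inject₁) ≈ con (+ p) ⊗ (B ⊗ B ⊗ κ)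
    ∑≈ = ≈-trans (S.sum-cong-≋ term) (≈-trans (≈-sym (S.*-distribˡ-sum (con (+ p) ⊗ (B ⊗ B)) κₖ))
      (solve 3 (λ p b k → p :* b :* k := p :* (b :* k)) ≈-refl (con (+ p)) (B ⊗ B) κ))

  -- Meant for B = p g: the remainder is then of order p² and keeps a factor p after one division by
  -- p.
  [A+B]^[1+n] : ∀ n A B → ∃[ κ ]
    (A ⊕ B) ↑ suc n ≈ (A ↑ suc n ⊕ con (+ suc n) ⊗ (A ↑ n ⊗ B)) ⊕ B ⊗ B ⊗ κ
  [A+B]^[1+n] zero A B = con 0ℤ ,
    solve 2 (λ a b → (a :+ b) :* :con 1ℤ := (a :* :con 1ℤ :+ :con 1ℤ :* (:con 1ℤ :* b)) :+ b :* b :* :con 0ℤ) ≈-refl A B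
  [A+B]^[1+n] (suc n) A B with [A+B]^[1+n] n A B
  ... | κ , eq = (A ⊗ κ ⊕ con (+ suc n) ⊗ A ↑ n) ⊕ B ⊗ κ , ≈-trans (*-congˡ eq)
    (≈-trans (solve 5 (λ a b aⁿ k κ → (a :+ b) :* ((a :* aⁿ :+ k :* (aⁿ :* b)) :+ b :* b :* κ) :=
        (a :* (a :* aⁿ) :+ (:con 1ℤ :+ k) :* ((a :* aⁿ) :* b)) :+ b :* b :* ((a :* κ :+ k :* aⁿ) :+ b :* κ)) ≈-refl
        A B (A ↑ n) (con (+ suc n)) κ)
      (+-congʳ (+-congˡ (*-congʳ (≗⇒≈ λ r → sym (ℤ.*-distribʳ-+ (δ N r) 1ℤ (+ suc n)))))))

-- Frobenius congruences

y : Op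
y = con 1ℤ ⊕ ⊖ x

act-x^ : ∀ k f r → act (x ↑ k) f r ≡ f (r ℤ.- + k)
act-x^ zero    f r = trans (ℤ.*-identityˡ (f r)) (cong f (sym (ℤ.+-identityʳ r)))
act-x^ (suc k) f r = trans (act-x^ k f (r ℤ.- 1ℤ)) (cong f (assoc r (+ k)))
  where
  assoc : ∀ r k → r ℤ.- 1ℤ ℤ.- k ≡ r ℤ.- (1ℤ ℤ.+ k)
  assoc = solve-∀

δ-periodic : ∀ N r → δ N (r ℤ.- + N) ≡ δ N r
δ-periodic N r = cong (if_then 1ℤ else 0ℤ) (does-⇔ (mk⇔
  (λ N∣r-N → subst (+ N ∣_) (r-N+N≡r r (+ N)) (ℤ.∣m∣n⇒∣m+n N∣r-N ℤ.∣-refl))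
  (λ N∣r → ℤ.∣m∣n⇒∣m-n N∣r ℤ.∣-refl))
  (+ N ∣? (r ℤ.- + N)) (+ N ∣? r))
  where
  r-N+N≡r : ∀ r N → r ℤ.- N ℤ.+ N ≡ r
  r-N+N≡r = solve-∀

x^N≈1 : ∀ N m → Quotient._≈_ N m (x ↑ N) (con 1ℤ)
x^N≈1 N m = Quotient.≗⇒≈ N m {x ↑ N} {con 1ℤ} x^N≗1
  where
  x^N≗1 : act (x ↑ N) (δ N) ≗ act (con 1ℤ) (δ N)
  x^N≗1 r = trans (act-x^ N (δ N) r) (trans (δ-periodic N r) (sym (ℤ.*-identityˡ (δ N r))))

module _ {N m : ℕ} where
  open Quotient N

  ≈₀⇒≈ : ∀ {u v} → _≈_ 0 u v → _≈_ m u v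
  ≈₀⇒≈ u≈v = ≗⇒≈ m λ r → ≡⟨0⟩⇒≡ (at u≈v r)

  con-m≈0 : _≈_ m (con (+ m)) (con 0ℤ)
  con-m≈0 = mk≈ λ r → divides (δ N r) (eq (+ m) (δ N r))
    where
    eq : ∀ m d → m ℤ.* d ℤ.- 0ℤ ℤ.* d ≡ d ℤ.* m
    eq = solve-∀

module Frobenius (N m n : ℕ) (p-prime : Prime (2 + n)) where
  open Quotient N m
  open Powers N m
  open Solver renaming (con to :con) using (solve; _:=_; _:+_; _:*_; :-_; _:-_)
  open ≈-Reasoning setoid

  private
    p = 2 + n
    P = con (+ p)

  freshman : ∀ A B → ∃[ κ ] (A ⊕ B) ↑ p ≈ (A ↑ p ⊕ B ↑ p) ⊕ P ⊗ κ
  freshman A B = let (κ , eq) = [A+B]^p n p-prime A B in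
    A ↑ suc n ⊗ B ⊕ B ⊗ B ⊗ κ , ≈-trans eq
    (solve 5 (λ a p b c d → (a :+ p :* b) :+ (p :* c :+ d) := (a :+ d) :+ p :* (b :+ c)) ≈-refl
      (A ↑ p) P (A ↑ suc n ⊗ B) (B ⊗ B ⊗ κ) (B ↑ p))

  private
    -- Expanding 0 = (1 + (- 1))^p treats p = 2, where the sign is wrong, together with the odd
    -- primes.
    -1^p : ∃[ κ ] con -1ℤ ↑ p ≈ con -1ℤ ⊕ P ⊗ κ
    -1^p = let (κ , eq) = freshman (con 1ℤ) (con -1ℤ) in ⊖ κ , (begin
      con -1ℤ ↑ p
        ≈⟨ solve 3 (λ u p κ → u := (:con -1ℤ :+ p :* (:- κ)) :+ ((:con 1ℤ :+ u) :+ p :* κ)) ≈-refl (con -1ℤ ↑ p) P κ ⟩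
      (con -1ℤ ⊕ P ⊗ ⊖ κ) ⊕ ((con 1ℤ ⊕ con -1ℤ ↑ p) ⊕ P ⊗ κ)
        ≈⟨ +-congˡ (≈-trans (+-congʳ (+-congʳ (≈-sym (1↑n≈1 p)))) (≈-sym eq)) ⟩
      (con -1ℤ ⊕ P ⊗ ⊖ κ) ⊕ (con 1ℤ ⊕ con -1ℤ) ↑ p
        ≈⟨ solve 2 (λ u v → u :+ (:con 1ℤ :+ :con -1ℤ) :* v := u) ≈-refl _ _ ⟩
      con -1ℤ ⊕ P ⊗ ⊖ κ ∎)

  [-u]^p : ∀ u → ∃[ κ ] (⊖ u) ↑ p ≈ ⊖ u ↑ p ⊕ P ⊗ (κ ⊗ u ↑ p)
  [-u]^p u = let (κ , eq) = -1^p in κ , (begin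
    (⊖ u) ↑ p                      ≈⟨ ↑-distrib-⊗ (con -1ℤ) u p ⟩
    con -1ℤ ↑ p ⊗ u ↑ p            ≈⟨ *-congʳ eq ⟩
    (con -1ℤ ⊕ P ⊗ κ) ⊗ u ↑ p      ≈⟨ solve 3 (λ p κ v → (:con -1ℤ :+ p :* κ) :* v := :- v :+ p :* (κ :* v)) ≈-refl P κ (u ↑ p) ⟩
    ⊖ u ↑ p ⊕ P ⊗ (κ ⊗ u ↑ p) ∎)

  -- Expand 1 = z^p = (1 - Z)^p and solve for Z^p. The linear term gives - p Z. Every other term
  -- left has the factor p Z², including the error p κ′ Z^p from the sign of (- Z)^p, because p ≥ 2.
  [1-z]^p : ∀ z → z ↑ p ≈ con 1ℤ → let Z = con 1ℤ ⊕ ⊖ z in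
    ∃[ t ] Z ↑ p ≈ ⊖ P ⊗ (Z ⊗ (con 1ℤ ⊕ ⊖ (Z ⊗ t)))
  [1-z]^p z z^p≈1 = κ ⊕ κ′ ⊗ Z ↑ n , (begin
    Z ↑ p
      ≈⟨ solve 1 (λ u → u := (:con 1ℤ :- :con 1ℤ) :+ u) ≈-refl (Z ↑ p) ⟩
    (con 1ℤ ⊕ ⊖ con 1ℤ) ⊕ Z ↑ p
      ≈⟨ +-congʳ (+-congʳ 1≈) ⟩
    (((con 1ℤ ⊕ P ⊗ (con 1ℤ ⊗ ⊖ Z)) ⊕ (P ⊗ (⊖ Z ⊗ ⊖ Z ⊗ κ) ⊕ (⊖ Z ↑ p ⊕ P ⊗ (κ′ ⊗ Z ↑ p)))) ⊕ ⊖ con 1ℤ) ⊕ Z ↑ p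
      ≈⟨ solve 5 (λ p z κ κ′ zⁿ → (((:con 1ℤ :+ p :* (:con 1ℤ :* :- z)) :+ (p :* (:- z :* :- z :* κ) :+
            (:- (z :* (z :* zⁿ)) :+ p :* (κ′ :* (z :* (z :* zⁿ)))))) :- :con 1ℤ) :+ z :* (z :* zⁿ)
          := :- p :* (z :* (:con 1ℤ :- (z :* (κ :+ κ′ :* zⁿ))))) ≈-refl P Z κ κ′ (Z ↑ n) ⟩
    ⊖ P ⊗ (Z ⊗ (con 1ℤ ⊕ ⊖ (Z ⊗ (κ ⊕ κ′ ⊗ Z ↑ n)))) ∎)
    where
    Z = con 1ℤ ⊕ ⊖ z
    expansion = [A+B]^p n p-prime (con 1ℤ) (⊖ Z)
    κ = proj₁ expansion
    κ′ = proj₁ ([-u]^p Z)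
    1≈ : con 1ℤ ≈ (con 1ℤ ⊕ P ⊗ (con 1ℤ ⊗ ⊖ Z)) ⊕ (P ⊗ (⊖ Z ⊗ ⊖ Z ⊗ κ) ⊕ (⊖ Z ↑ p ⊕ P ⊗ (κ′ ⊗ Z ↑ p)))
    1≈ = begin
      con 1ℤ            ≈⟨ z^p≈1 ⟨
      z ↑ p             ≈⟨ ↑-cong p (solve 1 (λ z → z := :con 1ℤ :+ :- (:con 1ℤ :+ :- z)) ≈-refl z) ⟩
      (con 1ℤ ⊕ ⊖ Z) ↑ p ≈⟨ proj₂ expansion ⟩
      (con 1ℤ ↑ p ⊕ P ⊗ (con 1ℤ ↑ suc n ⊗ ⊖ Z)) ⊕ (P ⊗ (⊖ Z ⊗ ⊖ Z ⊗ κ) ⊕ (⊖ Z) ↑ p)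
        ≈⟨ +-cong (+-cong (1↑n≈1 p) (*-congˡ (*-congʳ (1↑n≈1 (suc n))))) (+-congˡ (proj₂ ([-u]^p Z))) ⟩
      (con 1ℤ ⊕ P ⊗ (con 1ℤ ⊗ ⊖ Z)) ⊕ (P ⊗ (⊖ Z ⊗ ⊖ Z ⊗ κ) ⊕ (⊖ Z ↑ p ⊕ P ⊗ (κ′ ⊗ Z ↑ p))) ∎

  -- Iterated Frobenius with the remainder recorded. The modulus is left free: 0 produces the exact
  -- `g`, while p with exponent N gives y^N = 1 - x^N = 0.
  y^[p^a] : ∀ a → ∃[ g ] y ↑ (p ^ a) ≈ (con 1ℤ ⊕ ⊖ x ↑ (p ^ a)) ⊕ P ⊗ g
  y^[p^a] zero = con 0ℤ , solve 2 (λ x p → (:con 1ℤ :- x) :* :con 1ℤ := (:con 1ℤ :- x :* :con 1ℤ) :+ p :* :con 0ℤ) ≈-refl x P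
  y^[p^a] (suc a) = ((κ₂ ⊕ κ₃ ⊗ X ↑ p) ⊕ g ⊗ (P ⊗ g) ↑ suc n) ⊕ κ₁ , (begin
    y ↑ (p * q)                  ≈⟨ ↑-*′ y ⟨
    (y ↑ q) ↑ p                    ≈⟨ ↑-cong p (proj₂ (y^[p^a] a)) ⟩
    ((con 1ℤ ⊕ ⊖ X) ⊕ P ⊗ g) ↑ p   ≈⟨ proj₂ sum₁ ⟩
    ((con 1ℤ ⊕ ⊖ X) ↑ p ⊕ (P ⊗ g) ↑ p) ⊕ P ⊗ κ₁
      ≈⟨ +-congʳ (+-congʳ (≈-trans (proj₂ sum₂) (+-congʳ (+-cong (1↑n≈1 p) (proj₂ ([-u]^p X)))))) ⟩
    (((con 1ℤ ⊕ (⊖ X ↑ p ⊕ P ⊗ (κ₃ ⊗ X ↑ p))) ⊕ P ⊗ κ₂) ⊕ (P ⊗ g) ↑ p) ⊕ P ⊗ κ₁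
      ≈⟨ solve 7 (λ u p κ₃ κ₂ g h κ₁ → (((:con 1ℤ :+ (:- u :+ p :* (κ₃ :* u))) :+ p :* κ₂) :+ (p :* g) :* h) :+ p :* κ₁
           := (:con 1ℤ :- u) :+ p :* (((κ₂ :+ κ₃ :* u) :+ g :* h) :+ κ₁)) ≈-refl (X ↑ p) P κ₃ κ₂ g ((P ⊗ g) ↑ suc n) κ₁ ⟩
    (con 1ℤ ⊕ ⊖ X ↑ p) ⊕ P ⊗ (((κ₂ ⊕ κ₃ ⊗ X ↑ p) ⊕ g ⊗ (P ⊗ g) ↑ suc n) ⊕ κ₁)
      ≈⟨ +-congʳ (+-congˡ (-‿cong (↑-*′ x))) ⟩
    (con 1ℤ ⊕ ⊖ x ↑ (p * q)) ⊕ P ⊗ (((κ₂ ⊕ κ₃ ⊗ X ↑ p) ⊕ g ⊗ (P ⊗ g) ↑ suc n) ⊕ κ₁) ∎)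
    where
    q = p ^ a
    X = x ↑ q
    g = proj₁ (y^[p^a] a)
    sum₁ = freshman (con 1ℤ ⊕ ⊖ X) (P ⊗ g)
    sum₂ = freshman (con 1ℤ) (⊖ X)
    κ₁ = proj₁ sum₁
    κ₂ = proj₁ sum₂
    κ₃ = proj₁ ([-u]^p X)
    ↑-*′ : ∀ u → (u ↑ q) ↑ p ≈ u ↑ (p * q)
    ↑-*′ u = subst (λ k → (u ↑ q) ↑ p ≈ u ↑ k) (ℕ.*-comm q p) (↑-* u q p)

y^p^a≈0 : ∀ n → Prime (2 + n) → ∀ a → let p = 2 + n in Quotient._≈_ (p ^ a) p (y ↑ (p ^ a)) (con 0ℤ)
y^p^a≈0 n pp a = begin
  y ↑ N                                ≈⟨ proj₂ yᴺ ⟩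
  (con 1ℤ ⊕ ⊖ x ↑ N) ⊕ con (+ p) ⊗ proj₁ yᴺ ≈⟨ +-cong (+-congˡ (-‿cong (x^N≈1 N p))) (*-congʳ con-m≈0) ⟩
  (con 1ℤ ⊕ ⊖ con 1ℤ) ⊕ con 0ℤ ⊗ proj₁ yᴺ   ≈⟨ solve 1 (λ g → (:con 1ℤ :- :con 1ℤ) :+ :con 0ℤ :* g := :con 0ℤ) ≈-refl (proj₁ yᴺ) ⟩
  con 0ℤ ∎
  where
  p = 2 + n
  N = p ^ a
  yᴺ = Frobenius.y^[p^a] N p n pp a
  open Quotient N p
  open Solver renaming (con to :con) using (solve; _:=_; _:+_; _:*_; :-_; _:-_)
  open ≈-Reasoning setoid

module _ (n : ℕ) (p-prime : Prime (2 + n)) (a : ℕ) where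
  private
    p = 2 + n
    q = p ^ a
    N = p ^ suc a
    Y = y ↑ q
    module Q = Quotient N p

  Y^p≈0 : Y ↑ p Q.≈ con 0ℤ
  Y^p≈0 = Q.≈-trans (subst (λ k → Y ↑ p Q.≈ y ↑ k) (ℕ.*-comm q p) (Powers.↑-* N p y q p))
    (y^p^a≈0 n p-prime (suc a))

-- For p = 2 the factor Y^(p-2) is trivial, so Y g² = 0 needs g to be divisible modulo 2 by a
-- square root of Y: here g = - X y^q with q = 2^(a-1) and X = x^q.
module _ (p-prime : Prime 2) where

  y^[2^a]-remainder : ∀ a → let N = 2 ^ suc a ; Y = y ↑ (2 ^ a) in
    ∃[ g ] Quotient._≈_ N 0 Y ((con 1ℤ ⊕ ⊖ x ↑ (2 ^ a)) ⊕ con (+ 2) ⊗ g)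
         × Quotient._≈_ N 2 (Y ⊗ g ⊗ g) (con 0ℤ)
  y^[2^a]-remainder zero = con 0ℤ , solve 1 (λ x → (:con 1ℤ :- x) :* :con 1ℤ := (:con 1ℤ :- x :* :con 1ℤ) :+ :con (+ 2) :* :con 0ℤ) E.≈-refl x
    , Q.Solver.solve 1 (λ u → u Q.Solver.:* Q.Solver.con 0ℤ Q.Solver.:* Q.Solver.con 0ℤ Q.Solver.:= Q.Solver.con 0ℤ) Q.≈-refl (y ↑ 1)
    where
    module E = Quotient 2 0
    module Q = Quotient 2 2
    open E.Solver renaming (con to :con) using (solve; _:=_; _:+_; _:*_; :-_; _:-_)
  y^[2^a]-remainder (suc a) = g , exact , mod2
    where
    N = 2 ^ (2 + a)
    q = 2 ^ a
    module E = Quotient N 0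
    module Q = Quotient N 2
    root = Frobenius.y^[p^a] N 0 0 p-prime a
    g′ = proj₁ root
    X = x ↑ q
    -- Both `r` and `g` are read off from the square of 1 - X + 2 g′, with 1 - 2 X + X² written as
    -- (1 - X²) + 2 (X² - X).
    r = (con 1ℤ ⊕ ⊖ X) ⊗ g′ ⊕ g′ ⊗ g′
    g = (⊖ X ⊕ X ⊗ X) ⊕ con (+ 2) ⊗ r
    square : ∀ m u → Quotient._≈_ N m (u ↑ (2 * q)) (u ↑ q ⊗ u ↑ q)
    square m u = subst (λ k → Quotient._≈_ N m (u ↑ (q + k)) (u ↑ q ⊗ u ↑ q)) (sym (ℕ.+-identityʳ q))
      (Powers.↑-distribˡ-+ N m u q q)
    exact : y ↑ (2 * q) E.≈ (con 1ℤ ⊕ ⊖ x ↑ (2 * q)) ⊕ con (+ 2) ⊗ g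
    exact = begin
      y ↑ (2 * q)  ≈⟨ square 0 y ⟩
      y ↑ q ⊗ y ↑ q  ≈⟨ E.*-cong (proj₂ root) (proj₂ root) ⟩
      ((con 1ℤ ⊕ ⊖ X) ⊕ con (+ 2) ⊗ g′) ⊗ ((con 1ℤ ⊕ ⊖ X) ⊕ con (+ 2) ⊗ g′)
        ≈⟨ solve 2 (λ x g → ((:con 1ℤ :- x) :+ :con (+ 2) :* g) :* ((:con 1ℤ :- x) :+ :con (+ 2) :* g)
             := (:con 1ℤ :- x :* x) :+ :con (+ 2) :* ((:- x :+ x :* x) :+ :con (+ 2) :* ((:con 1ℤ :- x) :* g :+ g :* g))) E.≈-refl X g′ ⟩
      (con 1ℤ ⊕ ⊖ (X ⊗ X)) ⊕ con (+ 2) ⊗ g ≈⟨ E.+-congʳ (E.+-congˡ (E.-‿cong (square 0 x))) ⟨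
      (con 1ℤ ⊕ ⊖ x ↑ (2 * q)) ⊕ con (+ 2) ⊗ g ∎
      where
      open ≈-Reasoning E.setoid
      open E.Solver renaming (con to :con) using (solve; _:=_; _:+_; _:*_; :-_; _:-_)
    mod2 : y ↑ (2 * q) ⊗ g ⊗ g Q.≈ con 0ℤ
    mod2 = begin
      Y ⊗ g ⊗ g   ≈⟨ Q.*-cong (Q.*-congˡ g≈) g≈ ⟩
      Y ⊗ (⊖ X ⊗ y ↑ q) ⊗ (⊖ X ⊗ y ↑ q)
        ≈⟨ solve 3 (λ u x z → u :* (:- x :* z) :* (:- x :* z) := x :* x :* (u :* (z :* z))) Q.≈-refl Y X (y ↑ q) ⟩
      X ⊗ X ⊗ (Y ⊗ (y ↑ q ⊗ y ↑ q)) ≈⟨ Q.*-congˡ (Q.*-congˡ (Q.≈-trans (Q.≈-sym (square 2 y)) (solve 1 (λ u → u := u :* :con 1ℤ) Q.≈-refl Y))) ⟩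
      X ⊗ X ⊗ Y ↑ 2 ≈⟨ Q.*-congˡ (Y^p≈0 0 p-prime (suc a)) ⟩
      X ⊗ X ⊗ con 0ℤ ≈⟨ solve 1 (λ u → u :* :con 0ℤ := :con 0ℤ) Q.≈-refl (X ⊗ X) ⟩
      con 0ℤ ∎
      where
      open ≈-Reasoning Q.setoid
      open Q.Solver renaming (con to :con) using (solve; _:=_; _:+_; _:*_; :-_; _:-_)
      Y = y ↑ (2 * q)
      g≈ : g Q.≈ ⊖ X ⊗ y ↑ q
      g≈ = begin
        (⊖ X ⊕ X ⊗ X) ⊕ con (+ 2) ⊗ r  ≈⟨ Q.+-congˡ (Q.*-congʳ con-m≈0) ⟩
        (⊖ X ⊕ X ⊗ X) ⊕ con 0ℤ ⊗ r
          ≈⟨ solve 3 (λ x r g → (:- x :+ x :* x) :+ :con 0ℤ :* r := :- x :* ((:con 1ℤ :- x) :+ :con 0ℤ :* g)) Q.≈-refl X r g′ ⟩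
        ⊖ X ⊗ ((con 1ℤ ⊕ ⊖ X) ⊕ con 0ℤ ⊗ g′)     ≈⟨ Q.*-congˡ (Q.+-congˡ (Q.*-congʳ con-m≈0)) ⟨
        ⊖ X ⊗ ((con 1ℤ ⊕ ⊖ X) ⊕ con (+ 2) ⊗ g′) ≈⟨ Q.*-congˡ (≈₀⇒≈ (proj₂ root)) ⟨
        ⊖ X ⊗ y ↑ q ∎

-- The second property becomes Y B² = 0. For odd p the total exponent of Y is 1 + 2 (p - 2) = 2 p -
-- 3 ≥ p, so it follows from Y^p = 0 for any `g`; for p = 2 it depends on the particular `g`.
y^[p^a]-remainder : ∀ n → Prime (2 + n) → ∀ a →
  let p = 2 + n ; N = p ^ suc a ; Y = y ↑ (p ^ a) in
  ∃[ g ] Quotient._≈_ N 0 Y ((con 1ℤ ⊕ ⊖ x ↑ (p ^ a)) ⊕ con (+ p) ⊗ g)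
       × Quotient._≈_ N p (Y ⊗ (Y ↑ n ⊗ g) ⊗ (Y ↑ n ⊗ g)) (con 0ℤ)
y^[p^a]-remainder zero pp a = let (g , exact , mod2) = y^[2^a]-remainder pp a in
  g , exact , Q.≈-trans (solve 2 (λ u g → u :* (:con 1ℤ :* g) :* (:con 1ℤ :* g) := u :* g :* g) Q.≈-refl (y ↑ (2 ^ a)) g) mod2
  where
  module Q = Quotient (2 ^ suc a) 2
  open Q.Solver renaming (con to :con) using (solve; _:=_; _:+_; _:*_; :-_; _:-_)
y^[p^a]-remainder (suc n) pp a = g , proj₂ root , (begin
  Y ⊗ (Y ⊗ Y ↑ n ⊗ g) ⊗ (Y ⊗ Y ↑ n ⊗ g)
    ≈⟨ solve 3 (λ u v g → u :* (u :* v :* g) :* (u :* v :* g) := (u :* (u :* (u :* v))) :* (v :* g :* g)) Q.≈-refl Y (Y ↑ n) g ⟩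
  Y ↑ p ⊗ (Y ↑ n ⊗ g ⊗ g)      ≈⟨ Q.*-congʳ (Y^p≈0 (suc n) pp a) ⟩
  con 0ℤ ⊗ (Y ↑ n ⊗ g ⊗ g)     ≈⟨ solve 1 (λ u → :con 0ℤ :* u := :con 0ℤ) Q.≈-refl (Y ↑ n ⊗ g ⊗ g) ⟩
  con 0ℤ ∎)
  where
  p = 3 + n
  N = p ^ suc a
  Y = y ↑ (p ^ a)
  root = Frobenius.y^[p^a] N 0 (suc n) pp a
  g = proj₁ root
  module Q = Quotient N p
  open Q.Solver renaming (con to :con) using (solve; _:=_; _:+_; _:*_; :-_; _:-_)
  open ≈-Reasoning Q.setoid

-- The sequence M_e

module FleckOperator (n : ℕ) (p-prime : Prime (2 + n)) (a : ℕ) (g t κ : Op) where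
  private
    p = 2 + n
    q = p ^ a
    N = p ^ suc a
    P = con (+ p)
    k = con (+ suc n)
    Y = y ↑ q
    Z = con 1ℤ ⊕ ⊖ x ↑ q
    module E = Quotient N 0
    module Q = Quotient N p

  -- `W` is y^ϕ. `ε` is read off from Z W by expanding W = (Z + p g)^(p-1): the contributions Z^p,
  -- (p - 1) p Z^(p-1) g and p² g² κ Z are each divided by - p Z. `U` turns out to be the residue of
  -- ε + B.
  W U B ε : Op
  W = Y ↑ suc n
  U = con 1ℤ ⊕ ⊖ (Y ⊗ t)
  B = ⊖ (Y ↑ n ⊗ g)
  ε = ((con 1ℤ ⊕ ⊖ (Z ⊗ t)) ⊕ ⊖ (k ⊗ (Z ↑ n ⊗ g))) ⊕ ⊖ (P ⊗ (g ⊗ g ⊗ κ))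

  -- Split the factor Y of Y W^(e+1) as Z + p g. Next to Z, all e + 1 factors W become - p ε. Next
  -- to p g, one factor W = Y Y^(p-2) is opened: p g Y^(p-2) is - p B, and the remaining Y W^e is
  -- the previous stage.
  M : ℕ → Op
  M zero    = Y
  M (suc e) = Z ⊗ ε ↑ suc e ⊕ B ⊗ M e

  module Exact
    (Y≈Z+Pg : Y E.≈ Z ⊕ P ⊗ g)
    (Z^p≈ : Z ↑ p E.≈ ⊖ P ⊗ (Z ⊗ (con 1ℤ ⊕ ⊖ (Z ⊗ t))))
    (W≈ : W E.≈ (Z ↑ suc n ⊕ k ⊗ (Z ↑ n ⊗ (P ⊗ g))) ⊕ P ⊗ g ⊗ (P ⊗ g) ⊗ κ) where
    open E.Solver renaming (con to :con) using (solve; _:=_; _:+_; _:*_; :-_; _:-_)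
    open ≈-Reasoning E.setoid

    Z⊗W≈ : Z ⊗ W E.≈ ⊖ P ⊗ (ε ⊗ Z)
    Z⊗W≈ = begin
      Z ⊗ W
        ≈⟨ E.*-congˡ W≈ ⟩
      Z ⊗ ((Z ↑ suc n ⊕ k ⊗ (Z ↑ n ⊗ (P ⊗ g))) ⊕ P ⊗ g ⊗ (P ⊗ g) ⊗ κ)
        ≈⟨ solve 6 (λ z zⁿ k p g κ → z :* ((z :* zⁿ :+ k :* (zⁿ :* (p :* g))) :+ p :* g :* (p :* g) :* κ)
             := z :* (z :* zⁿ) :+ z :* (k :* (zⁿ :* (p :* g)) :+ p :* g :* (p :* g) :* κ)) E.≈-refl Z (Z ↑ n) k P g κ ⟩
      Z ↑ p ⊕ Z ⊗ (k ⊗ (Z ↑ n ⊗ (P ⊗ g)) ⊕ P ⊗ g ⊗ (P ⊗ g) ⊗ κ)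
        ≈⟨ E.+-congʳ Z^p≈ ⟩
      ⊖ P ⊗ (Z ⊗ (con 1ℤ ⊕ ⊖ (Z ⊗ t))) ⊕ Z ⊗ (k ⊗ (Z ↑ n ⊗ (P ⊗ g)) ⊕ P ⊗ g ⊗ (P ⊗ g) ⊗ κ)
        ≈⟨ solve 7 (λ z zⁿ k p g κ t → :- p :* (z :* (:con 1ℤ :- z :* t)) :+ z :* (k :* (zⁿ :* (p :* g)) :+ p :* g :* (p :* g) :* κ)
             := :- p :* ((((:con 1ℤ :- z :* t) :- k :* (zⁿ :* g)) :- p :* (g :* g :* κ)) :* z)) E.≈-refl Z (Z ↑ n) k P g κ t ⟩
      ⊖ P ⊗ (ε ⊗ Z) ∎

    [-P]^e⊗ε^e⊗Z : ∀ e → (⊖ P) ↑ e ⊗ ε ↑ e ⊗ Z E.≈ Z ⊗ W ↑ e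
    [-P]^e⊗ε^e⊗Z zero = solve 1 (λ z → :con 1ℤ :* :con 1ℤ :* z := z :* :con 1ℤ) E.≈-refl Z
    [-P]^e⊗ε^e⊗Z (suc e) = begin
      ⊖ P ⊗ (⊖ P) ↑ e ⊗ (ε ⊗ ε ↑ e) ⊗ Z
        ≈⟨ solve 5 (λ p pᵉ ε εᵉ z → :- p :* pᵉ :* (ε :* εᵉ) :* z := pᵉ :* εᵉ :* (:- p :* (ε :* z))) E.≈-refl P ((⊖ P) ↑ e) ε (ε ↑ e) Z ⟩
      (⊖ P) ↑ e ⊗ ε ↑ e ⊗ (⊖ P ⊗ (ε ⊗ Z))
        ≈⟨ E.*-congˡ Z⊗W≈ ⟨
      (⊖ P) ↑ e ⊗ ε ↑ e ⊗ (Z ⊗ W)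
        ≈⟨ solve 3 (λ u z w → u :* (z :* w) := w :* (u :* z)) E.≈-refl ((⊖ P) ↑ e ⊗ ε ↑ e) Z W ⟩
      W ⊗ ((⊖ P) ↑ e ⊗ ε ↑ e ⊗ Z)
        ≈⟨ E.*-congˡ ([-P]^e⊗ε^e⊗Z e) ⟩
      W ⊗ (Z ⊗ W ↑ e)
        ≈⟨ solve 3 (λ w z v → w :* (z :* v) := z :* (w :* v)) E.≈-refl W Z (W ↑ e) ⟩
      Z ⊗ W ↑ suc e ∎

    [-P]^e⊗M : ∀ e → (⊖ P) ↑ e ⊗ M e E.≈ Y ⊗ W ↑ e
    [-P]^e⊗M zero = solve 1 (λ u → :con 1ℤ :* u := u :* :con 1ℤ) E.≈-refl Y
    [-P]^e⊗M (suc e) = begin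
      ⊖ P ⊗ (⊖ P) ↑ e ⊗ (Z ⊗ ε ↑ suc e ⊕ B ⊗ M e)
        ≈⟨ solve 6 (λ p pᵉ z v b m → :- p :* pᵉ :* (z :* v :+ b :* m) := :- p :* pᵉ :* v :* z :+ :- p :* b :* (pᵉ :* m))
             E.≈-refl P ((⊖ P) ↑ e) Z (ε ↑ suc e) B (M e) ⟩
      ⊖ P ⊗ (⊖ P) ↑ e ⊗ ε ↑ suc e ⊗ Z ⊕ ⊖ P ⊗ B ⊗ ((⊖ P) ↑ e ⊗ M e)
        ≈⟨ E.+-cong ([-P]^e⊗ε^e⊗Z (suc e)) (E.*-congˡ ([-P]^e⊗M e)) ⟩
      Z ⊗ W ↑ suc e ⊕ ⊖ P ⊗ B ⊗ (Y ⊗ W ↑ e)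
        ≈⟨ solve 6 (λ z u uⁿ v p g → z :* ((u :* uⁿ) :* v) :+ :- p :* (:- (uⁿ :* g)) :* (u :* v)
             := (z :+ p :* g) :* ((u :* uⁿ) :* v)) E.≈-refl Z Y (Y ↑ n) (W ↑ e) P g ⟩
      (Z ⊕ P ⊗ g) ⊗ W ↑ suc e
        ≈⟨ E.*-congʳ Y≈Z+Pg ⟨
      Y ⊗ W ↑ suc e ∎

  module Residue
    (Y≈Z+Pg : Y E.≈ Z ⊕ P ⊗ g)
    (Y⊗[Y^n⊗g]²≈0 : Y ⊗ (Y ↑ n ⊗ g) ⊗ (Y ↑ n ⊗ g) Q.≈ con 0ℤ) where
    open Powers N p
    open Frobenius N p n p-prime
    open Q.Solver renaming (con to :con) using (solve; _:=_; _:+_; _:*_; :-_; _:-_)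
    open ≈-Reasoning Q.setoid

    P≈0 : P Q.≈ con 0ℤ
    P≈0 = con-m≈0

    Y^p⊗ : ∀ u → Y ↑ p ⊗ u Q.≈ con 0ℤ
    Y^p⊗ u = Q.≈-trans (Q.*-congʳ (Y^p≈0 n p-prime a)) (solve 1 (λ u → :con 0ℤ :* u := :con 0ℤ) Q.≈-refl u)

    Z≈Y : Z Q.≈ Y
    Z≈Y = begin
      Z              ≈⟨ solve 2 (λ z g → z := z :+ :con 0ℤ :* g) Q.≈-refl Z g ⟩
      Z ⊕ con 0ℤ ⊗ g ≈⟨ Q.+-congˡ (Q.*-congʳ P≈0) ⟨
      Z ⊕ P ⊗ g      ≈⟨ ≈₀⇒≈ Y≈Z+Pg ⟨
      Y ∎

    k≈-1 : k Q.≈ con -1ℤ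
    k≈-1 = begin
      con (+ suc n)    ≈⟨ Q.≗⇒≈ {con (+ suc n)} {P ⊕ con -1ℤ} (λ r → ℤ.*-distribʳ-+ (δ N r) (+ p) -1ℤ) ⟩
      P ⊕ con -1ℤ      ≈⟨ Q.+-congʳ P≈0 ⟩
      con 0ℤ ⊕ con -1ℤ ≈⟨ solve 0 (:con 0ℤ :+ :con -1ℤ := :con -1ℤ) Q.≈-refl ⟩
      con -1ℤ ∎

    ε≈U-B : ε Q.≈ U ⊕ ⊖ B
    ε≈U-B = begin
      ε ≈⟨ Q.+-cong (Q.+-cong (Q.+-congˡ (Q.-‿cong (Q.*-congʳ Z≈Y)))
             (Q.-‿cong (Q.*-cong k≈-1 (Q.*-congʳ (↑-cong n Z≈Y))))) (Q.-‿cong (Q.*-congʳ P≈0)) ⟩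
      ((con 1ℤ ⊕ ⊖ (Y ⊗ t)) ⊕ ⊖ (con -1ℤ ⊗ (Y ↑ n ⊗ g))) ⊕ ⊖ (con 0ℤ ⊗ (g ⊗ g ⊗ κ))
        ≈⟨ solve 3 (λ u v w → (u :- :con -1ℤ :* v) :- :con 0ℤ :* w := u :- (:- v)) Q.≈-refl U (Y ↑ n ⊗ g) (g ⊗ g ⊗ κ) ⟩
      U ⊕ ⊖ B ∎

    U≈ε+B : U Q.≈ ε ⊕ B
    U≈ε+B = Q.≈-trans (solve 2 (λ u b → u := (u :- b) :+ b) Q.≈-refl U B) (Q.+-congʳ (Q.≈-sym ε≈U-B))

    Y⊗B⊗B≈0 : Y ⊗ B ⊗ B Q.≈ con 0ℤ
    Y⊗B⊗B≈0 = Q.≈-trans (solve 2 (λ u v → u :* :- v :* :- v := u :* v :* v) Q.≈-refl Y (Y ↑ n ⊗ g)) Y⊗[Y^n⊗g]²≈0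

    -- With M_(e+1) = Y (ε + B) ε^e, the recursion gives Y ε^(e+2) + Y B (ε + B) ε^e, which differs
    -- from Y (ε + B) ε^(e+1) only by a multiple of Y B² = 0.
    M≈ : ∀ e → M (suc e) Q.≈ Y ⊗ (U ⊗ ε ↑ e)
    M≈ zero = begin
      Z ⊗ (ε ⊗ con 1ℤ) ⊕ B ⊗ Y ≈⟨ Q.+-congʳ (Q.*-congʳ Z≈Y) ⟩
      Y ⊗ (ε ⊗ con 1ℤ) ⊕ B ⊗ Y ≈⟨ solve 3 (λ u ε b → u :* (ε :* :con 1ℤ) :+ b :* u := u :* ((ε :+ b) :* :con 1ℤ)) Q.≈-refl Y ε B ⟩
      Y ⊗ ((ε ⊕ B) ⊗ con 1ℤ)   ≈⟨ Q.*-congˡ (Q.*-congʳ U≈ε+B) ⟨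
      Y ⊗ (U ⊗ con 1ℤ) ∎
    M≈ (suc e) = begin
      Z ⊗ (ε ⊗ (ε ⊗ ε ↑ e)) ⊕ B ⊗ M (suc e)
        ≈⟨ Q.+-cong (Q.*-congʳ Z≈Y) (Q.*-congˡ (Q.≈-trans (M≈ e) (Q.*-congˡ (Q.*-congʳ U≈ε+B)))) ⟩
      Y ⊗ (ε ⊗ (ε ⊗ ε ↑ e)) ⊕ B ⊗ (Y ⊗ ((ε ⊕ B) ⊗ ε ↑ e))
        ≈⟨ solve 4 (λ u ε v b → u :* (ε :* (ε :* v)) :+ b :* (u :* ((ε :+ b) :* v))
             := u :* ((ε :+ b) :* (ε :* v)) :+ u :* b :* b :* v) Q.≈-refl Y ε (ε ↑ e) B ⟩
      Y ⊗ ((ε ⊕ B) ⊗ ε ↑ suc e) ⊕ Y ⊗ B ⊗ B ⊗ ε ↑ e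
        ≈⟨ Q.+-cong (Q.*-congˡ (Q.*-congʳ (Q.≈-sym U≈ε+B))) (Q.*-congʳ Y⊗B⊗B≈0) ⟩
      Y ⊗ (U ⊗ ε ↑ suc e) ⊕ con 0ℤ ⊗ ε ↑ e
        ≈⟨ solve 2 (λ u v → u :+ :con 0ℤ :* v := u) Q.≈-refl _ (ε ↑ e) ⟩
      Y ⊗ (U ⊗ ε ↑ suc e) ∎

    drop-P : ∀ u v → u ⊕ P ⊗ v Q.≈ u
    drop-P u v = Q.≈-trans (Q.+-congˡ (Q.*-congʳ P≈0)) (solve 2 (λ u v → u :+ :con 0ℤ :* v := u) Q.≈-refl u v)

    U^p≈1 : U ↑ p Q.≈ con 1ℤ
    U^p≈1 = begin
      U ↑ p ≈⟨ ↑-cong p (solve 2 (λ u t → :con 1ℤ :- u :* t := :con 1ℤ :+ u :* :- t) Q.≈-refl Y t) ⟩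
      (con 1ℤ ⊕ Y ⊗ ⊖ t) ↑ p
        ≈⟨ Q.≈-trans (proj₂ (freshman (con 1ℤ) (Y ⊗ ⊖ t))) (drop-P _ _) ⟩
      con 1ℤ ↑ p ⊕ (Y ⊗ ⊖ t) ↑ p
        ≈⟨ Q.+-cong (1↑n≈1 p) (Q.≈-trans (↑-distrib-⊗ Y (⊖ t) p) (Y^p⊗ ((⊖ t) ↑ p))) ⟩
      con 1ℤ ⊕ con 0ℤ
        ≈⟨ solve 0 (:con 1ℤ :+ :con 0ℤ := :con 1ℤ) Q.≈-refl ⟩
      con 1ℤ ∎

    -- By Frobenius ε^p = U^p + (- B)^p. Here U^p = 1 because (Y t)^p = 0, and (- B)^p contains B²
    -- because p ≥ 2, so Y kills it.
    Y⊗ε^p≈Y : Y ⊗ ε ↑ p Q.≈ Y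
    Y⊗ε^p≈Y = begin
      Y ⊗ ε ↑ p        ≈⟨ Q.*-congˡ (↑-cong p ε≈U-B) ⟩
      Y ⊗ (U ⊕ ⊖ B) ↑ p
        ≈⟨ Q.*-congˡ (Q.≈-trans (proj₂ (freshman U (⊖ B))) (drop-P _ _)) ⟩
      Y ⊗ (U ↑ p ⊕ (⊖ B) ↑ p)
        ≈⟨ Q.*-congˡ (Q.+-congʳ U^p≈1) ⟩
      Y ⊗ (con 1ℤ ⊕ ⊖ B ⊗ (⊖ B ⊗ (⊖ B) ↑ n))
        ≈⟨ solve 3 (λ u b v → u :* (:con 1ℤ :+ :- b :* (:- b :* v)) := u :+ u :* b :* b :* v) Q.≈-refl Y B ((⊖ B) ↑ n) ⟩
      Y ⊕ Y ⊗ B ⊗ B ⊗ (⊖ B) ↑ n ≈⟨ Q.+-congˡ (Q.*-congʳ Y⊗B⊗B≈0) ⟩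
      Y ⊕ con 0ℤ ⊗ (⊖ B) ↑ n    ≈⟨ solve 2 (λ u v → u :+ :con 0ℤ :* v := u) Q.≈-refl Y ((⊖ B) ↑ n) ⟩
      Y ∎

    Y⊗[ε^p]^e≈Y : ∀ e → Y ⊗ (ε ↑ p) ↑ e Q.≈ Y
    Y⊗[ε^p]^e≈Y zero    = solve 1 (λ u → u :* :con 1ℤ := u) Q.≈-refl Y
    Y⊗[ε^p]^e≈Y (suc e) = begin
      Y ⊗ (ε ↑ p ⊗ (ε ↑ p) ↑ e) ≈⟨ solve 3 (λ u v w → u :* (v :* w) := u :* v :* w) Q.≈-refl Y (ε ↑ p) ((ε ↑ p) ↑ e) ⟩
      Y ⊗ ε ↑ p ⊗ (ε ↑ p) ↑ e   ≈⟨ Q.*-congʳ Y⊗ε^p≈Y ⟩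
      Y ⊗ (ε ↑ p) ↑ e           ≈⟨ Y⊗[ε^p]^e≈Y e ⟩
      Y ∎

    M-periodic : ∀ e → M (suc (p + e)) Q.≈ M (suc e)
    M-periodic e = begin
      M (suc (p + e))         ≈⟨ M≈ (p + e) ⟩
      Y ⊗ (U ⊗ ε ↑ (p + e))   ≈⟨ Q.*-congˡ (Q.*-congˡ (↑-distribˡ-+ ε p e)) ⟩
      Y ⊗ (U ⊗ (ε ↑ p ⊗ ε ↑ e)) ≈⟨ solve 4 (λ y u v w → y :* (u :* (v :* w)) := y :* v :* (u :* w)) Q.≈-refl Y U (ε ↑ p) (ε ↑ e) ⟩
      Y ⊗ ε ↑ p ⊗ (U ⊗ ε ↑ e)   ≈⟨ Q.*-congʳ Y⊗ε^p≈Y ⟩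
      Y ⊗ (U ⊗ ε ↑ e)           ≈⟨ M≈ e ⟨
      M (suc e) ∎

    -- M_p is Y ε^p + Y B ε^(p-1), hence Y plus an error with the factor Y B. One more Y makes this
    -- error a multiple of Y² Y^(p-2) = Y^p = 0.
    Y⊗M[p]≈Y⊗M[0] : Y ⊗ M p Q.≈ Y ⊗ M 0
    Y⊗M[p]≈Y⊗M[0] = begin
      Y ⊗ M p
        ≈⟨ Q.*-congˡ (Q.≈-trans (M≈ (suc n)) (Q.*-congˡ (Q.*-congʳ U≈ε+B))) ⟩
      Y ⊗ (Y ⊗ ((ε ⊕ ⊖ (Y ↑ n ⊗ g)) ⊗ ε ↑ suc n))
        ≈⟨ solve 5 (λ u uⁿ ε v g → u :* (u :* ((ε :- uⁿ :* g) :* v)) := u :* (u :* (ε :* v)) :+ u :* (u :* uⁿ) :* (:- g :* v))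
             Q.≈-refl Y (Y ↑ n) ε (ε ↑ suc n) g ⟩
      Y ⊗ (Y ⊗ ε ↑ p) ⊕ Y ↑ p ⊗ (⊖ g ⊗ ε ↑ suc n)
        ≈⟨ Q.+-cong (Q.*-congˡ Y⊗ε^p≈Y) (Y^p⊗ _) ⟩
      Y ⊗ Y ⊕ con 0ℤ
        ≈⟨ solve 1 (λ u → u :+ :con 0ℤ := u) Q.≈-refl (Y ⊗ Y) ⟩
      Y ⊗ Y ∎

    W⊗M≈0 : ∀ e → W ⊗ M e Q.≈ con 0ℤ
    W⊗M≈0 zero = Q.≈-trans (solve 2 (λ w u → w :* u := u :* w :* :con 1ℤ) Q.≈-refl W Y) (Y^p⊗ (con 1ℤ))
    W⊗M≈0 (suc e) = Q.≈-trans (Q.*-congˡ (M≈ e))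
      (Q.≈-trans (solve 3 (λ w u v → w :* (u :* v) := u :* w :* v) Q.≈-refl W Y (U ⊗ ε ↑ e)) (Y^p⊗ (U ⊗ ε ↑ e)))

    -- For M_(e+1) = Y U ε^e, the factor (ε^e)^(p-1) completes ε^e to (ε^p)^e, which Y absorbs. What
    -- is left of U = 1 - Y t disappears against `v`, whose product with Y² is zero; this avoids
    -- inverting U.
    M-divides : ∀ e → ∃[ u ] ∀ v → v ⊗ Y ⊗ Y Q.≈ con 0ℤ → v ⊗ u ⊗ M e Q.≈ v ⊗ Y
    M-divides zero    = con 1ℤ , λ v _ → solve 2 (λ v y → v :* :con 1ℤ :* y := v :* y) Q.≈-refl v Y
    M-divides (suc e) = (ε ↑ e) ↑ suc n , λ v v⊗Y⊗Y≈0 → begin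
      v ⊗ (ε ↑ e) ↑ suc n ⊗ M (suc e)
        ≈⟨ Q.*-congˡ (M≈ e) ⟩
      v ⊗ (ε ↑ e) ↑ suc n ⊗ (Y ⊗ (U ⊗ ε ↑ e))
        ≈⟨ solve 5 (λ v w y u z → v :* w :* (y :* (u :* z)) := v :* u :* (y :* (z :* w))) Q.≈-refl v ((ε ↑ e) ↑ suc n) Y U (ε ↑ e) ⟩
      v ⊗ U ⊗ (Y ⊗ (ε ↑ e) ↑ p)
        ≈⟨ Q.*-congˡ (Q.*-congˡ (Q.≈-trans (↑-* ε e p) (Q.≈-trans (Q.≈-reflexive (cong (ε ↑_) (ℕ.*-comm e p))) (Q.≈-sym (↑-* ε p e))))) ⟩
      v ⊗ U ⊗ (Y ⊗ (ε ↑ p) ↑ e)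
        ≈⟨ Q.*-congˡ (Y⊗[ε^p]^e≈Y e) ⟩
      v ⊗ U ⊗ Y
        ≈⟨ solve 3 (λ v y t → v :* (:con 1ℤ :- y :* t) :* y := v :* y :+ v :* y :* y :* :- t) Q.≈-refl v Y t ⟩
      v ⊗ Y ⊕ v ⊗ Y ⊗ Y ⊗ ⊖ t
        ≈⟨ Q.+-congˡ (Q.*-congʳ v⊗Y⊗Y≈0) ⟩
      v ⊗ Y ⊕ con 0ℤ ⊗ ⊖ t
        ≈⟨ solve 2 (λ u t → u :+ :con 0ℤ :* t := u) Q.≈-refl (v ⊗ Y) (⊖ t) ⟩
      v ⊗ Y ∎

-- The interface to the sequence M_e that hides `g`, `t`, `κ` and `ε`. Here q = p ^ a and N = p ^
-- suc a, so `a` is one less than the exponent in the theorem.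
record FleckFamily (n a : ℕ) : Set where
  p = 2 + n
  q = p ^ a
  N = p ^ suc a
  open Quotient N 0 using () renaming (_≈_ to _≈₀_)
  open Quotient N p using () renaming (_≈_ to _≈ₚ_)
  field
    M              : ℕ → Op
    [-p]^e⊗M≈      : ∀ e → (⊖ con (+ p)) ↑ e ⊗ M e ≈₀ y ↑ q ⊗ ((y ↑ q) ↑ suc n) ↑ e
    M[1+p+e]≈      : ∀ e → M (suc (p + e)) ≈ₚ M (suc e)
    y^q⊗M[p]≈      : y ↑ q ⊗ M p ≈ₚ y ↑ q ⊗ M 0
    y^φ⊗M≈0        : ∀ e → (y ↑ q) ↑ suc n ⊗ M e ≈ₚ con 0ℤ
    M∣y^q          : ∀ e → ∃[ u ] ∀ v → v ⊗ y ↑ q ⊗ y ↑ q ≈ₚ con 0ℤ → v ⊗ u ⊗ M e ≈ₚ v ⊗ y ↑ q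

fleckFamily : ∀ n → Prime (2 + n) → ∀ a → FleckFamily n a
fleckFamily n p-prime a = record
  { M         = M
  ; [-p]^e⊗M≈ = [-P]^e⊗M
  ; M[1+p+e]≈ = M-periodic
  ; y^q⊗M[p]≈ = Y⊗M[p]≈Y⊗M[0]
  ; y^φ⊗M≈0   = W⊗M≈0
  ; M∣y^q       = M-divides
  }
  where
  p = 2 + n
  q = p ^ a
  N = p ^ suc a
  module E = Quotient N 0
  P = con (+ p)
  Z = con 1ℤ ⊕ ⊖ x ↑ q
  remainder = y^[p^a]-remainder n p-prime a
  g = proj₁ remainder
  root-of-unity : (x ↑ q) ↑ p E.≈ con 1ℤ
  root-of-unity = E.≈-trans (Powers.↑-* N 0 x q p)
    (subst (λ k → x ↑ k E.≈ con 1ℤ) (ℕ.*-comm p q) (x^N≈1 N 0))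
  Z^p = Frobenius.[1-z]^p N 0 n p-prime (x ↑ q) root-of-unity
  expansion = Powers.[A+B]^[1+n] N 0 n Z (P ⊗ g)
  open FleckOperator n p-prime a g (proj₁ Z^p) (proj₁ expansion)
  open Exact (proj₁ (proj₂ remainder)) (proj₂ Z^p)
    (E.≈-trans (Powers.↑-cong N 0 (suc n) (proj₁ (proj₂ remainder))) (proj₂ expansion))
  open Residue (proj₁ (proj₂ remainder)) (proj₂ (proj₂ remainder))

-- Coefficients of y^n and Newton's formula

act-y : ∀ u f r → act (y ⊗ u) f r ≡ act u f r ℤ.- act u f (r ℤ.- 1ℤ)
act-y u f r = eq (act u f r) (act u f (r ℤ.- 1ℤ))
  where
  eq : ∀ i j → 1ℤ ℤ.* i ℤ.+ -1ℤ ℤ.* j ≡ i ℤ.- j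
  eq = solve-∀

private
  term : (n : ℕ) (f : ℤ → ℤ) (r : ℤ) (k : ℕ) → ℤ
  term n f r k = + (n C k) ℤ.* -1ℤ ℤ.^ k ℤ.* f (r ℤ.- + k)

∑-0 : ∀ n {g : Fin n → ℤ} → (∀ k → g k ≡ 0ℤ) → sumℤ g ≡ 0ℤ
∑-0 n g≡0 = trans (∑ℤ.sum-cong-≗ g≡0) (∑ℤ.sum-replicate-zero n)

-- Any number of terms beyond the n-th may be included, which frees the induction from boundary terms.
act-y^ : ∀ n L → n ℕ.< L → ∀ f r → act (y ↑ n) f r ≡ sumℤ {L} (term n f r ∘ toℕ)
act-y^ zero (suc L) _ f r = begin
  1ℤ ℤ.* f r ≡⟨ cong (λ s → 1ℤ ℤ.* f s) (ℤ.+-identityʳ r) ⟨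
  term 0 f r 0 ≡⟨ ℤ.+-identityʳ _ ⟨
  term 0 f r 0 ℤ.+ 0ℤ ≡⟨ cong (λ s → term 0 f r 0 ℤ.+ s) (∑-0 L (λ k → eq (-1ℤ ℤ.^ suc (toℕ k)) (f (r ℤ.- + suc (toℕ k))))) ⟨
  term 0 f r 0 ℤ.+ sumℤ {L} (term 0 f r ∘ suc ∘ toℕ) ∎
  where
  open ≡-Reasoning
  eq : ∀ i j → 0ℤ ℤ.* i ℤ.* j ≡ 0ℤ
  eq = solve-∀
act-y^ (suc n) (suc L) (ℕ.s≤s n<L) f r = begin
  act (y ↑ suc n) f r
    ≡⟨ act-y (y ↑ n) f r ⟩
  act (y ↑ n) f r ℤ.- act (y ↑ n) f (r ℤ.- 1ℤ)
    ≡⟨ cong₂ ℤ._-_ (act-y^ n (suc L) (ℕ.m<n⇒m<1+n n<L) f r) (act-y^ n L n<L f (r ℤ.- 1ℤ)) ⟩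
  (term n f r 0 ℤ.+ S) ℤ.- S′
    ≡⟨ rearrange (term n f r 0) S S′ ⟩
  term n f r 0 ℤ.+ (S ℤ.+ -1ℤ ℤ.* S′)
    ≡⟨ cong (λ s → term n f r 0 ℤ.+ (S ℤ.+ s)) (∑ℤ.*-distribˡ-sum {L} -1ℤ (term n f (r ℤ.- 1ℤ) ∘ toℕ)) ⟩
  term n f r 0 ℤ.+ (S ℤ.+ sumℤ {L} (λ k → -1ℤ ℤ.* term n f (r ℤ.- 1ℤ) (toℕ k)))
    ≡⟨ cong₂ ℤ._+_ first (trans (sym (∑ℤ.∑-distrib-+ {L} (term n f r ∘ suc ∘ toℕ) (λ k → -1ℤ ℤ.* term n f (r ℤ.- 1ℤ) (toℕ k))))
         (∑ℤ.sum-cong-≗ {L} (λ k → pascal (toℕ k)))) ⟩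
  term (suc n) f r 0 ℤ.+ sumℤ {L} (term (suc n) f r ∘ suc ∘ toℕ) ∎
  where
  open ≡-Reasoning
  S  = sumℤ {L} (term n f r ∘ suc ∘ toℕ)
  S′ = sumℤ {L} (term n f (r ℤ.- 1ℤ) ∘ toℕ)
  rearrange : ∀ i j k → (i ℤ.+ j) ℤ.- k ≡ i ℤ.+ (j ℤ.+ -1ℤ ℤ.* k)
  rearrange = solve-∀
  first : term n f r 0 ≡ term (suc n) f r 0
  first = refl
  pascal : ∀ k → term n f r (suc k) ℤ.+ -1ℤ ℤ.* term n f (r ℤ.- 1ℤ) k ≡ term (suc n) f r (suc k)
  pascal k = begin
    c′ ℤ.* (-1ℤ ℤ.* ε) ℤ.* f (r ℤ.- + suc k) ℤ.+ -1ℤ ℤ.* (c ℤ.* ε ℤ.* f (r ℤ.- 1ℤ ℤ.- + k))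
      ≡⟨ cong (λ s → c′ ℤ.* (-1ℤ ℤ.* ε) ℤ.* f (r ℤ.- + suc k) ℤ.+ -1ℤ ℤ.* (c ℤ.* ε ℤ.* f s)) (assoc r (+ k)) ⟩
    c′ ℤ.* (-1ℤ ℤ.* ε) ℤ.* f (r ℤ.- + suc k) ℤ.+ -1ℤ ℤ.* (c ℤ.* ε ℤ.* f (r ℤ.- + suc k))
      ≡⟨ collect c′ c ε (f (r ℤ.- + suc k)) ⟩
    (c ℤ.+ c′) ℤ.* (-1ℤ ℤ.* ε) ℤ.* f (r ℤ.- + suc k)
      ≡⟨ cong (λ s → s ℤ.* (-1ℤ ℤ.* ε) ℤ.* f (r ℤ.- + suc k)) (trans (sym (ℤ.pos-+ (n C k) (n C suc k))) (cong +_ (nCk+nC[k+1]≡[n+1]C[k+1] n k))) ⟩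
    term (suc n) f r (suc k) ∎
    where
    c  = + (n C k)
    c′ = + (n C suc k)
    ε  = -1ℤ ℤ.^ k
    assoc : ∀ r k → r ℤ.- 1ℤ ℤ.- k ≡ r ℤ.- (1ℤ ℤ.+ k)
    assoc = solve-∀
    collect : ∀ c′ c ε u → c′ ℤ.* (-1ℤ ℤ.* ε) ℤ.* u ℤ.+ -1ℤ ℤ.* (c ℤ.* ε ℤ.* u) ≡ (c ℤ.+ c′) ℤ.* (-1ℤ ℤ.* ε) ℤ.* u
    collect = solve-∀

altSum≡act : ∀ N n r → altSum N n r ≡ act (y ↑ n) (δ N) r
altSum≡act N n r = sym (trans (act-y^ n (suc n) (ℕ.n<1+n n) (δ N) r) (∑ℤ.sum-cong-≗ {suc n} (λ k → select (toℕ k))))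
  where
  neg-sub : ∀ i j → ℤ.- (i ℤ.- j) ≡ j ℤ.- i
  neg-sub = solve-∀
  select : ∀ k → term n (δ N) r k ≡ (if does (+ N ∣? (+ k ℤ.- r)) then + (n C k) ℤ.* -1ℤ ℤ.^ k else 0ℤ)
  select k rewrite does-⇔ (mk⇔ (λ d → subst (+ N ∣_) (neg-sub r (+ k)) (ℤ.∣m⇒∣-m d))
                              (λ d → subst (+ N ∣_) (neg-sub (+ k) r) (ℤ.∣m⇒∣-m d)))
                          (+ N ∣? (r ℤ.- + k)) (+ N ∣? (+ k ℤ.- r))
    with does (+ N ∣? (+ k ℤ.- r))
  ... | true  = ℤ.*-identityʳ _
  ... | false = ℤ.*-zeroʳ (+ (n C k) ℤ.* -1ℤ ℤ.^ k)

-- The degree of y^N is below the period N + 1, so no other exponent wraps around to 0.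
act-y^[N-1] : ∀ N → act (y ↑ N) (δ (suc N)) 0ℤ ≡ 1ℤ
act-y^[N-1] N = begin
  act (y ↑ N) (δ (suc N)) 0ℤ ≡⟨ act-y^ N (suc N) (ℕ.n<1+n N) (δ (suc N)) 0ℤ ⟩
  term N (δ (suc N)) 0ℤ 0 ℤ.+ sumℤ {N} (term N (δ (suc N)) 0ℤ ∘ suc ∘ toℕ)
    ≡⟨ cong₂ (λ i j → + (N C 0) ℤ.* 1ℤ ℤ.* i ℤ.+ j)
         (cong (if_then 1ℤ else 0ℤ) (dec-true (+ suc N ∣? 0ℤ) (divides 0ℤ (sym (ℤ.*-zeroˡ (+ suc N))))))
         (∑-0 N vanish) ⟩
  1ℤ ∎
  where
  open ≡-Reasoning
  vanish : ∀ (k : Fin N) → term N (δ (suc N)) 0ℤ (suc (toℕ k)) ≡ 0ℤ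
  vanish k = trans (cong (λ b → + (N C suc (toℕ k)) ℤ.* -1ℤ ℤ.^ suc (toℕ k) ℤ.* (if b then 1ℤ else 0ℤ))
      (dec-false (+ suc N ∣? (0ℤ ℤ.- + suc (toℕ k))) (λ d → ℕ.>⇒∤ (ℕ.s≤s (toℕ<n k)) (ℤ.∣⇒∣ᵤ d))))
    (ℤ.*-zeroʳ (+ (N C suc (toℕ k)) ℤ.* -1ℤ ℤ.^ suc (toℕ k)))

-- Generalised binomial coefficients and backward differences over ℤ

ℤ-induction : (Q : ℤ → Set) → Q 0ℤ → (∀ r → Q (r ℤ.- 1ℤ) → Q r) → (∀ r → Q r → Q (r ℤ.- 1ℤ)) → ∀ r → Q r
ℤ-induction Q base up down (+ zero)        = base
ℤ-induction Q base up down (+ suc n)       = up (+ suc n) (ℤ-induction Q base up down (+ n))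
ℤ-induction Q base up down -[1+ zero ]     = down 0ℤ base
ℤ-induction Q base up down -[1+ suc n ]    =
  subst (λ k → Q -[1+ suc k ]) (ℕ.+-identityʳ n) (down -[1+ n ] (ℤ-induction Q base up down -[1+ n ]))

-- multichoose k r is the generalised binomial coefficient of r + k - 1 over k.
multichoose : ℕ → ℤ → ℤ
multichoose zero    r            = 1ℤ
multichoose (suc k) (+ zero)     = 0ℤ
multichoose (suc k) (+ suc n)    = multichoose (suc k) (+ n) ℤ.+ multichoose k (+ suc n)
multichoose (suc k) -[1+ zero ]  = 0ℤ ℤ.- multichoose k 0ℤ
multichoose (suc k) -[1+ suc n ] = multichoose (suc k) -[1+ n ] ℤ.- multichoose k -[1+ n ]

multichoose-pascal : ∀ k r → multichoose (suc k) r ≡ multichoose (suc k) (r ℤ.- 1ℤ) ℤ.+ multichoose k r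
multichoose-pascal k (+ zero) = sym (cancel 0ℤ (multichoose k 0ℤ))
  where
  cancel : ∀ i j → i ℤ.- j ℤ.+ j ≡ i
  cancel = solve-∀
multichoose-pascal k (+ suc n) = refl
multichoose-pascal k -[1+ n ] rewrite ℕ.+-identityʳ n = sym (cancel (multichoose (suc k) -[1+ n ]) (multichoose k -[1+ n ]))
  where
  cancel : ∀ i j → i ℤ.- j ℤ.+ j ≡ i
  cancel = solve-∀

fallingFactorial-suc : ∀ z k → fallingFactorial z (suc k) ≡ z ℤ.* fallingFactorial (z ℤ.- 1ℤ) k
fallingFactorial-suc z zero    = eq z
  where
  eq : ∀ z → 1ℤ ℤ.* (z ℤ.- 0ℤ) ≡ z ℤ.* 1ℤ
  eq = solve-∀
fallingFactorial-suc z (suc k) = trans (cong (ℤ._* (z ℤ.- + suc k)) (fallingFactorial-suc z k))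
  (eq z (fallingFactorial (z ℤ.- 1ℤ) k) (+ k))
  where
  eq : ∀ z u k → z ℤ.* u ℤ.* (z ℤ.- (1ℤ ℤ.+ k)) ≡ z ℤ.* (u ℤ.* (z ℤ.- 1ℤ ℤ.- k))
  eq = solve-∀

private
  rising : ℕ → ℤ → ℤ
  rising k r = fallingFactorial (r ℤ.+ + k ℤ.- 1ℤ) k

rising-pascal : ∀ k r → rising (suc k) r ≡ rising (suc k) (r ℤ.- 1ℤ) ℤ.+ + suc k ℤ.* rising k r
rising-pascal k r = begin
  fallingFactorial (r ℤ.+ + suc k ℤ.- 1ℤ) (suc k) ≡⟨ fallingFactorial-suc (r ℤ.+ + suc k ℤ.- 1ℤ) k ⟩
  (r ℤ.+ + suc k ℤ.- 1ℤ) ℤ.* fallingFactorial (r ℤ.+ + suc k ℤ.- 1ℤ ℤ.- 1ℤ) k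
    ≡⟨ cong (λ s → (r ℤ.+ + suc k ℤ.- 1ℤ) ℤ.* fallingFactorial s k) (shift₁ r (+ k)) ⟩
  (r ℤ.+ + suc k ℤ.- 1ℤ) ℤ.* rising k r ≡⟨ eq r (+ k) (rising k r) ⟩
  rising k r ℤ.* (r ℤ.+ + k ℤ.- 1ℤ ℤ.- + k) ℤ.+ + suc k ℤ.* rising k r
    ≡⟨ cong (λ s → fallingFactorial s (suc k) ℤ.+ + suc k ℤ.* rising k r) (shift₂ r (+ k)) ⟨
  rising (suc k) (r ℤ.- 1ℤ) ℤ.+ + suc k ℤ.* rising k r ∎
  where
  open ≡-Reasoning
  shift₁ : ∀ r k → r ℤ.+ (1ℤ ℤ.+ k) ℤ.- 1ℤ ℤ.- 1ℤ ≡ r ℤ.+ k ℤ.- 1ℤ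
  shift₁ = solve-∀
  shift₂ : ∀ r k → r ℤ.- 1ℤ ℤ.+ (1ℤ ℤ.+ k) ℤ.- 1ℤ ≡ r ℤ.+ k ℤ.- 1ℤ
  shift₂ = solve-∀
  eq : ∀ r k u → (r ℤ.+ (1ℤ ℤ.+ k) ℤ.- 1ℤ) ℤ.* u ≡ u ℤ.* (r ℤ.+ k ℤ.- 1ℤ ℤ.- k) ℤ.+ (1ℤ ℤ.+ k) ℤ.* u
  eq = solve-∀

-- Clearing the denominator k ! keeps the comparison in ℤ. For k > 0 both sides obey the same
-- recurrence in r, usable in both directions, and vanish at r = 0, where the falling factorial of k
-- - 1 with k factors ends in zero.
multichoose-! : ∀ k r → fallingFactorial (r ℤ.+ + k ℤ.- 1ℤ) k ≡ multichoose k r ℤ.* + (k !)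
multichoose-! zero    r = refl
multichoose-! (suc k) = ℤ-induction (λ r → rising (suc k) r ≡ multichoose (suc k) r ℤ.* + (suc k !)) base up down
  where
  open ≡-Reasoning
  base : fallingFactorial (+ k) k ℤ.* (+ k ℤ.- + k) ≡ 0ℤ ℤ.* + (suc k !)
  base = trans (cong (fallingFactorial (+ k) k ℤ.*_) (ℤ.+-inverseʳ (+ k)))
    (trans (ℤ.*-zeroʳ (fallingFactorial (+ k) k)) (sym (ℤ.*-zeroˡ (+ (suc k !)))))
  increment : ∀ r → + suc k ℤ.* rising k r ≡ multichoose k r ℤ.* + (suc k !)
  increment r = begin
    + suc k ℤ.* rising k r                      ≡⟨ cong (+ suc k ℤ.*_) (multichoose-! k r) ⟩
    + suc k ℤ.* (multichoose k r ℤ.* + (k !))   ≡⟨ eq (+ suc k) (multichoose k r) (+ (k !)) ⟩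
    multichoose k r ℤ.* (+ suc k ℤ.* + (k !))   ≡⟨ cong (multichoose k r ℤ.*_) (ℤ.pos-* (suc k) (k !)) ⟨
    multichoose k r ℤ.* + (suc k !) ∎
    where
    eq : ∀ i j l → i ℤ.* (j ℤ.* l) ≡ j ℤ.* (i ℤ.* l)
    eq = solve-∀
  up : ∀ r → rising (suc k) (r ℤ.- 1ℤ) ≡ multichoose (suc k) (r ℤ.- 1ℤ) ℤ.* + (suc k !) →
       rising (suc k) r ≡ multichoose (suc k) r ℤ.* + (suc k !)
  up r ih = begin
    rising (suc k) r ≡⟨ rising-pascal k r ⟩
    rising (suc k) (r ℤ.- 1ℤ) ℤ.+ + suc k ℤ.* rising k r ≡⟨ cong₂ ℤ._+_ ih (increment r) ⟩
    multichoose (suc k) (r ℤ.- 1ℤ) ℤ.* + (suc k !) ℤ.+ multichoose k r ℤ.* + (suc k !)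
      ≡⟨ ℤ.*-distribʳ-+ (+ (suc k !)) (multichoose (suc k) (r ℤ.- 1ℤ)) (multichoose k r) ⟨
    (multichoose (suc k) (r ℤ.- 1ℤ) ℤ.+ multichoose k r) ℤ.* + (suc k !)
      ≡⟨ cong (ℤ._* + (suc k !)) (multichoose-pascal k r) ⟨
    multichoose (suc k) r ℤ.* + (suc k !) ∎
  down : ∀ r → rising (suc k) r ≡ multichoose (suc k) r ℤ.* + (suc k !) →
       rising (suc k) (r ℤ.- 1ℤ) ≡ multichoose (suc k) (r ℤ.- 1ℤ) ℤ.* + (suc k !)
  down r ih = ℤ-+-cancelʳ (+ suc k ℤ.* rising k r) _ _ (begin
    rising (suc k) (r ℤ.- 1ℤ) ℤ.+ + suc k ℤ.* rising k r ≡⟨ rising-pascal k r ⟨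
    rising (suc k) r ≡⟨ ih ⟩
    multichoose (suc k) r ℤ.* + (suc k !) ≡⟨ cong (ℤ._* + (suc k !)) (multichoose-pascal k r) ⟩
    (multichoose (suc k) (r ℤ.- 1ℤ) ℤ.+ multichoose k r) ℤ.* + (suc k !)
      ≡⟨ ℤ.*-distribʳ-+ (+ (suc k !)) (multichoose (suc k) (r ℤ.- 1ℤ)) (multichoose k r) ⟩
    multichoose (suc k) (r ℤ.- 1ℤ) ℤ.* + (suc k !) ℤ.+ multichoose k r ℤ.* + (suc k !)
      ≡⟨ cong (λ s → multichoose (suc k) (r ℤ.- 1ℤ) ℤ.* + (suc k !) ℤ.+ s) (increment r) ⟨
    multichoose (suc k) (r ℤ.- 1ℤ) ℤ.* + (suc k !) ℤ.+ + suc k ℤ.* rising k r ∎)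

-- Induction on L: the backward difference of the right-hand side is the expansion of F 1, to which
-- the hypothesis for the shifted family applies. At r = 0 only the term j = 0 survives, and the
-- differences propagate the congruence up and down ℤ.
newton : ∀ m (F : ℕ → ℤ → ℤ) → (∀ j r → F (suc j) r ≡ F j r ℤ.- F j (r ℤ.- 1ℤ)) →
         ∀ L → (∀ r → F L r ≡ 0ℤ ⟨ m ⟩) →
         ∀ r → F 0 r ≡ sumℤ {L} (λ j → multichoose (toℕ j) r ℤ.* F (toℕ j) 0ℤ) ⟨ m ⟩
newton m F ΔF zero    F≡0 r = F≡0 r
newton m F ΔF (suc L) F≡0   = ℤ-induction (λ r → F 0 r ≡ S r ⟨ m ⟩) base up down
  where
  open ≡-Reasoning
  S S′ : ℤ → ℤ
  S  r = sumℤ {suc L} (λ j → multichoose (toℕ j) r ℤ.* F (toℕ j) 0ℤ)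
  S′ r = sumℤ {L} (λ j → multichoose (toℕ j) r ℤ.* F (suc (toℕ j)) 0ℤ)
  F₁≡S′ : ∀ r → F 1 r ≡ S′ r ⟨ m ⟩
  F₁≡S′ = newton m (F ∘ suc) (ΔF ∘ suc) L F≡0
  S-step : ∀ r → S r ≡ S (r ℤ.- 1ℤ) ℤ.+ S′ r
  S-step r = begin
    S r
      ≡⟨ cong (λ s → 1ℤ ℤ.* F 0 0ℤ ℤ.+ s) (trans (∑ℤ.sum-cong-≗ {L} pascal) (∑ℤ.∑-distrib-+ {L} _ _)) ⟩
    1ℤ ℤ.* F 0 0ℤ ℤ.+ (sumℤ {L} (λ j → multichoose (suc (toℕ j)) (r ℤ.- 1ℤ) ℤ.* F (suc (toℕ j)) 0ℤ) ℤ.+ S′ r)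
      ≡⟨ ℤ.+-assoc (1ℤ ℤ.* F 0 0ℤ) _ (S′ r) ⟨
    S (r ℤ.- 1ℤ) ℤ.+ S′ r ∎
    where
    pascal : ∀ (j : Fin L) → multichoose (suc (toℕ j)) r ℤ.* F (suc (toℕ j)) 0ℤ ≡
      multichoose (suc (toℕ j)) (r ℤ.- 1ℤ) ℤ.* F (suc (toℕ j)) 0ℤ ℤ.+ multichoose (toℕ j) r ℤ.* F (suc (toℕ j)) 0ℤ
    pascal j = trans (cong (ℤ._* F (suc (toℕ j)) 0ℤ) (multichoose-pascal (toℕ j) r))
      (ℤ.*-distribʳ-+ (F (suc (toℕ j)) 0ℤ) (multichoose (suc (toℕ j)) (r ℤ.- 1ℤ)) (multichoose (toℕ j) r))
  base : F 0 0ℤ ≡ S 0ℤ ⟨ m ⟩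
  base = ⟨⟩-reflexive (begin
    F 0 0ℤ                ≡⟨ eq (F 0 0ℤ) ⟩
    1ℤ ℤ.* F 0 0ℤ ℤ.+ 0ℤ  ≡⟨ cong (λ s → 1ℤ ℤ.* F 0 0ℤ ℤ.+ s) (∑-0 L (λ j → ℤ.*-zeroˡ (F (suc (toℕ j)) 0ℤ))) ⟨
    S 0ℤ ∎)
    where
    eq : ∀ i → i ≡ 1ℤ ℤ.* i ℤ.+ 0ℤ
    eq = solve-∀
  up : ∀ r → F 0 (r ℤ.- 1ℤ) ≡ S (r ℤ.- 1ℤ) ⟨ m ⟩ → F 0 r ≡ S r ⟨ m ⟩
  up r ih = subst (+ m ∣_) (begin
    (F 0 (r ℤ.- 1ℤ) ℤ.- S (r ℤ.- 1ℤ)) ℤ.+ (F 1 r ℤ.- S′ r)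
      ≡⟨ cong (λ u → (F 0 (r ℤ.- 1ℤ) ℤ.- S (r ℤ.- 1ℤ)) ℤ.+ (u ℤ.- S′ r)) (ΔF 0 r) ⟩
    (F 0 (r ℤ.- 1ℤ) ℤ.- S (r ℤ.- 1ℤ)) ℤ.+ (F 0 r ℤ.- F 0 (r ℤ.- 1ℤ) ℤ.- S′ r)
      ≡⟨ eq (F 0 (r ℤ.- 1ℤ)) (S (r ℤ.- 1ℤ)) (F 0 r) (S′ r) ⟩
    F 0 r ℤ.- (S (r ℤ.- 1ℤ) ℤ.+ S′ r)
      ≡⟨ cong (λ u → F 0 r ℤ.- u) (S-step r) ⟨
    F 0 r ℤ.- S r ∎) (ℤ.∣m∣n⇒∣m+n ih (F₁≡S′ r))
    where
    eq : ∀ i j k l → (i ℤ.- j) ℤ.+ (k ℤ.- i ℤ.- l) ≡ k ℤ.- (j ℤ.+ l)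
    eq = solve-∀
  down : ∀ r → F 0 r ≡ S r ⟨ m ⟩ → F 0 (r ℤ.- 1ℤ) ≡ S (r ℤ.- 1ℤ) ⟨ m ⟩
  down r ih = subst (+ m ∣_) (begin
    (F 0 r ℤ.- S r) ℤ.- (F 1 r ℤ.- S′ r)
      ≡⟨ cong₂ (λ u v → (F 0 r ℤ.- u) ℤ.- (v ℤ.- S′ r)) (S-step r) (ΔF 0 r) ⟩
    (F 0 r ℤ.- (S (r ℤ.- 1ℤ) ℤ.+ S′ r)) ℤ.- (F 0 r ℤ.- F 0 (r ℤ.- 1ℤ) ℤ.- S′ r)
      ≡⟨ eq (F 0 r) (S (r ℤ.- 1ℤ)) (S′ r) (F 0 (r ℤ.- 1ℤ)) ⟩
    F 0 (r ℤ.- 1ℤ) ℤ.- S (r ℤ.- 1ℤ) ∎) (ℤ.∣m∣n⇒∣m-n ih (F₁≡S′ r))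
    where
    eq : ∀ i j k l → (i ℤ.- (j ℤ.+ k)) ℤ.- (i ℤ.- l ℤ.- k) ≡ l ℤ.- j
    eq = solve-∀

-- Fleck quotients

private
  -- `fromℤ` goes through normalisation and is stuck on a variable integer; this literal form with
  -- denominator 1 lets ℚ arithmetic compute.
  normalForm : ℤ → ℚ
  normalForm z = ℚ.mkℚ z 0 (Coprimality.sym (Coprimality.1-coprimeTo ℤ.∣ z ∣))

  fromℤ≡normalForm : ∀ z → fromℤ z ≡ normalForm z
  fromℤ≡normalForm z = ℚ.↥p/↧p≡p (normalForm z)

fromℤ-* : ∀ i j → fromℤ (i ℤ.* j) ≡ fromℤ i ℚ.* fromℤ j
fromℤ-* i j = sym (cong₂ ℚ._*_ (fromℤ≡normalForm i) (fromℤ≡normalForm j))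

fromℤ-+ : ∀ i j → fromℤ (i ℤ.+ j) ≡ fromℤ i ℚ.+ fromℤ j
fromℤ-+ i j = trans (cong₂ (λ k l → fromℤ (k ℤ.+ l)) (sym (ℤ.*-identityʳ i)) (sym (ℤ.*-identityʳ j)))
  (sym (cong₂ ℚ._+_ (fromℤ≡normalForm i) (fromℤ≡normalForm j)))

fromℤ-sum : ∀ n (f : Fin n → ℤ) → sumℚ (fromℤ ∘ f) ≡ fromℤ (sumℤ f)
fromℤ-sum zero    f = refl
fromℤ-sum (suc n) f = trans (cong (fromℤ (f Fin.zero) ℚ.+_) (fromℤ-sum n (f ∘ Fin.suc)))
  (sym (fromℤ-+ (f Fin.zero) (sumℤ (f ∘ Fin.suc))))

neg≡fromℤ : ∀ p .{{_ : NonZero p}} → neg p ≡ fromℤ (ℤ.- + p)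
neg≡fromℤ (suc p) = refl

[i*d]/d : ∀ i d .{{_ : NonZero d}} → (i ℤ.* + d) ℚ./ d ≡ fromℤ i
[i*d]/d i (suc d) = ℚ.fromℚᵘ-cong {ℚᵘ.mkℚᵘ (i ℤ.* + suc d) d} {ℚᵘ.mkℚᵘ i 0} (ℚᵘ.*≡* (ℤ.*-identityʳ (i ℤ.* + suc d)))

binom-multichoose : ∀ r k → binom (r ℤ.+ + k ℤ.- 1ℤ) k ≡ fromℤ (multichoose k r)
binom-multichoose r k = trans (cong (λ i → (i ℚ./ k !) {{k ℕ.!≢0}}) (multichoose-! k r))
  ([i*d]/d (multichoose k r) (k !) {{k ℕ.!≢0}})

1/z^n*z^n≡1 : ∀ z .{{_ : ℚ.NonZero z}} n → (ℚ.1/ z) ^ℚ n ℚ.* z ^ℚ n ≡ 1ℚ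
1/z^n*z^n≡1 z zero    = refl
1/z^n*z^n≡1 z (suc n) = begin
  (ℚ.1/ z ℚ.* u) ℚ.* (z ℚ.* v)   ≡⟨ ℚ.*-assoc (ℚ.1/ z) u (z ℚ.* v) ⟩
  ℚ.1/ z ℚ.* (u ℚ.* (z ℚ.* v))   ≡⟨ cong (ℚ.1/ z ℚ.*_) (ℚ.*-assoc u z v) ⟨
  ℚ.1/ z ℚ.* (u ℚ.* z ℚ.* v)     ≡⟨ cong (λ w → ℚ.1/ z ℚ.* (w ℚ.* v)) (ℚ.*-comm u z) ⟩
  ℚ.1/ z ℚ.* (z ℚ.* u ℚ.* v)     ≡⟨ cong (ℚ.1/ z ℚ.*_) (ℚ.*-assoc z u v) ⟩
  ℚ.1/ z ℚ.* (z ℚ.* (u ℚ.* v))   ≡⟨ ℚ.*-assoc (ℚ.1/ z) z (u ℚ.* v) ⟨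
  ℚ.1/ z ℚ.* z ℚ.* (u ℚ.* v)     ≡⟨ cong₂ ℚ._*_ (ℚ.*-inverseˡ z) (1/z^n*z^n≡1 z n) ⟩
  1ℚ ∎
  where
  open ≡-Reasoning
  u = (ℚ.1/ z) ^ℚ n
  v = z ^ℚ n

z^-n*z^n≡1 : ∀ z .{{_ : ℚ.NonZero z}} n → (z ^ℤ (ℤ.- + n)) ℚ.* z ^ℚ n ≡ 1ℚ
z^-n*z^n≡1 z zero    = refl
z^-n*z^n≡1 z (suc n) = 1/z^n*z^n≡1 z (suc n)

fromℤ-^ : ∀ i n → fromℤ (i ℤ.^ n) ≡ fromℤ i ^ℚ n
fromℤ-^ i zero    = refl
fromℤ-^ i (suc n) = trans (fromℤ-* i (i ℤ.^ n)) (cong (fromℤ i ℚ.*_) (fromℤ-^ i n))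

neg^ : ∀ p .{{_ : NonZero p}} → ℤ → ℚ
neg^ p = _^ℤ_ (neg p) {{neg-nonZero p}}

neg^-e*[-p]^e*z : ∀ p .{{_ : NonZero p}} e z →
  neg^ p (ℤ.- + e) ℚ.* fromℤ ((ℤ.- + p) ℤ.^ e ℤ.* z) ≡ fromℤ z
neg^-e*[-p]^e*z p e z = begin
  u ℚ.* fromℤ ((ℤ.- + p) ℤ.^ e ℤ.* z)            ≡⟨ cong (u ℚ.*_) (fromℤ-* ((ℤ.- + p) ℤ.^ e) z) ⟩
  u ℚ.* (fromℤ ((ℤ.- + p) ℤ.^ e) ℚ.* fromℤ z)    ≡⟨ cong (λ v → u ℚ.* (v ℚ.* fromℤ z)) (trans (fromℤ-^ (ℤ.- + p) e) (cong (_^ℚ e) (sym (neg≡fromℤ p)))) ⟩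
  u ℚ.* (neg p ^ℚ e ℚ.* fromℤ z)                 ≡⟨ ℚ.*-assoc u (neg p ^ℚ e) (fromℤ z) ⟨
  u ℚ.* neg p ^ℚ e ℚ.* fromℤ z                   ≡⟨ cong (ℚ._* fromℤ z) (z^-n*z^n≡1 (neg p) {{neg-nonZero p}} e) ⟩
  1ℚ ℚ.* fromℤ z                                 ≡⟨ ℚ.*-identityˡ (fromℤ z) ⟩
  fromℤ z ∎
  where
  open ≡-Reasoning
  u = neg^ p (ℤ.- + e)

[m+n]-m≡n : ∀ m n → + (m + n) ℤ.- + m ≡ + n
[m+n]-m≡n m n = trans (cong (ℤ._- + m) (ℤ.pos-+ m n)) (eq (+ m) (+ n))
  where
  eq : ∀ i j → i ℤ.+ j ℤ.- i ≡ j
  eq = solve-∀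

m-1-[m+n]≡-[1+n] : ∀ m n → + m ℤ.- 1ℤ ℤ.- + (m + n) ≡ -[1+ n ]
m-1-[m+n]≡-[1+n] m n = trans (cong (λ i → + m ℤ.- 1ℤ ℤ.- i) (ℤ.pos-+ m n)) (eq (+ m) (+ n))
  where
  eq : ∀ i j → i ℤ.- 1ℤ ℤ.- (i ℤ.+ j) ≡ ℤ.- (1ℤ ℤ.+ j)
  eq = solve-∀

[s+ed]/d≡e : ∀ s e d .{{_ : NonZero d}} → s ℕ.< d → (s + e * d) ℕ./ d ≡ e
[s+ed]/d≡e s e d s<d = begin
  (s + e * d) ℕ./ d       ≡⟨ ℕ.+-distrib-/-∣ʳ s (ℕ.n∣m*n e) ⟩
  s ℕ./ d + e * d ℕ./ d   ≡⟨ cong₂ _+_ (ℕ.m<n⇒m/n≡0 s<d) (ℕ.m*n/n≡m e d) ⟩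
  e ∎
  where open ≡-Reasoning

-- `%ℕ` at a negative argument branches on the remainder of its absolute value; this lemma and the
-- next resolve the two branches.
%ℕ-neg-suc : ∀ t d .{{_ : NonZero d}} {r} → suc t ℕ.% d ≡ suc r → -[1+ t ] ℤ.%ℕ d ≡ d ∸ suc r
%ℕ-neg-suc t d eq with suc t ℕ.% d
%ℕ-neg-suc t d refl | suc r = refl

%ℕ-neg-zero : ∀ t d .{{_ : NonZero d}} → suc t ℕ.% d ≡ 0 → -[1+ t ] ℤ.%ℕ d ≡ 0
%ℕ-neg-zero t d eq with suc t ℕ.% d
%ℕ-neg-zero t d refl | zero = refl

-[1+s+ed]%d : ∀ s e d .{{_ : NonZero d}} → s ℕ.< d → -[1+ s + e * d ] ℤ.%ℕ d ≡ d ∸ suc s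
-[1+s+ed]%d s e d s<d with ℕ.m≤n⇒m<n∨m≡n s<d
... | inj₁ 1+s<d = %ℕ-neg-suc (s + e * d) d (trans (ℕ.[m+kn]%n≡m%n (suc s) e d) (ℕ.m<n⇒m%n≡m 1+s<d))
-- At the end of a block, suc s = d, the residue wraps to 0 and the truncated difference is 0 as
-- well.
... | inj₂ refl  = trans (%ℕ-neg-zero (s + e * d) d (trans (ℕ.[m+kn]%n≡m%n (suc s) e d) (ℕ.n%n≡0 d)))
                         (sym (ℕ.n∸n≡0 (suc s)))

-- Fleck quotients along the blocks q + s + e ϕ with s < ϕ

module Value (n : ℕ) (p-prime : Prime (2 + n)) (a : ℕ) where
  open FleckFamily (fleckFamily n p-prime a)
  private
    module E = Quotient N 0
    module Q = Quotient N p
    instance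
      q≢0 : NonZero q
      q≢0 = ℕ.m^n≢0 p a

  ϕ : ℕ
  ϕ = q * suc n

  φ≡ϕ : φ (p ^ suc a) ≡ ϕ
  φ≡ϕ = φ[p^[1+a]]≡p^a*[p-1] p p-prime a

  -- Defined for every `s`, although it is used as a Fleck quotient only for s < ϕ: the difference
  -- formula runs on to s = ϕ with `e` fixed, where the value vanishes modulo p.
  value : ℕ → ℕ → ℤ → ℤ
  value e s = act (y ↑ s ⊗ M e) (δ N)

  [-p]^e-act : ∀ e u f r → act ((⊖ con (+ p)) ↑ e ⊗ u) f r ≡ (ℤ.- + p) ℤ.^ e ℤ.* act u f r
  [-p]^e-act zero    u f r = refl
  [-p]^e-act (suc e) u f r = trans (cong (λ i → -1ℤ ℤ.* (+ p ℤ.* i)) ([-p]^e-act e u f r))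
    (eq (+ p) ((ℤ.- + p) ℤ.^ e) (act u f r))
    where
    eq : ∀ p u v → -1ℤ ℤ.* (p ℤ.* (u ℤ.* v)) ≡ ℤ.- p ℤ.* u ℤ.* v
    eq = solve-∀

  y^[q+s+eϕ]≈ : ∀ s e → y ↑ (q + (s + e * ϕ)) E.≈ (⊖ con (+ p)) ↑ e ⊗ (y ↑ s ⊗ M e)
  y^[q+s+eϕ]≈ s e = begin
    y ↑ (q + (s + e * ϕ))
      ≈⟨ E.≈-trans (↑-distribˡ-+ y q _) (E.*-congˡ (↑-distribˡ-+ y s _)) ⟩
    y ↑ q ⊗ (y ↑ s ⊗ y ↑ (e * ϕ))
      ≈⟨ E.*-congˡ (E.*-congˡ (E.≈-reflexive (cong (y ↑_) (ℕ.*-comm e ϕ)))) ⟩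
    y ↑ q ⊗ (y ↑ s ⊗ y ↑ (ϕ * e))
      ≈⟨ E.*-congˡ (E.*-congˡ (E.≈-trans (↑-cong e (↑-* y q (suc n))) (↑-* y ϕ e))) ⟨
    y ↑ q ⊗ (y ↑ s ⊗ ((y ↑ q) ↑ suc n) ↑ e)
      ≈⟨ solve 3 (λ u v w → u :* (v :* w) := v :* (u :* w)) E.≈-refl (y ↑ q) (y ↑ s) (((y ↑ q) ↑ suc n) ↑ e) ⟩
    y ↑ s ⊗ (y ↑ q ⊗ ((y ↑ q) ↑ suc n) ↑ e)
      ≈⟨ E.*-congˡ ([-p]^e⊗M≈ e) ⟨
    y ↑ s ⊗ ((⊖ con (+ p)) ↑ e ⊗ M e)
      ≈⟨ solve 3 (λ u v w → u :* (v :* w) := v :* (u :* w)) E.≈-refl (y ↑ s) ((⊖ con (+ p)) ↑ e) (M e) ⟩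
    (⊖ con (+ p)) ↑ e ⊗ (y ↑ s ⊗ M e) ∎
    where
    open Powers N 0
    open ≈-Reasoning E.setoid
    open E.Solver using (solve; _:=_; _:*_)

  altSum≡[-p]^e*value : ∀ {m} e s → m ≡ q + (s + e * ϕ) → ∀ r →
    altSum N m r ≡ (ℤ.- + p) ℤ.^ e ℤ.* value e s r
  altSum≡[-p]^e*value e s refl r = begin
    altSum N (q + (s + e * ϕ)) r                       ≡⟨ altSum≡act N (q + (s + e * ϕ)) r ⟩
    act (y ↑ (q + (s + e * ϕ))) (δ N) r                ≡⟨ ≡⟨0⟩⇒≡ (E.at (y^[q+s+eϕ]≈ s e) r) ⟩
    act ((⊖ con (+ p)) ↑ e ⊗ (y ↑ s ⊗ M e)) (δ N) r    ≡⟨ [-p]^e-act e (y ↑ s ⊗ M e) (δ N) r ⟩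
    (ℤ.- + p) ℤ.^ e ℤ.* value e s r ∎
    where open ≡-Reasoning

  fleckExponent≡ : ∀ {m} e s → m ≡ q + (s + e * ϕ) → s ℕ.< ϕ → fleckExponent p (suc a) m ≡ + e
  fleckExponent≡ e s refl s<ϕ = trans (cong (λ i → (i ℤ./ℕ φ N) {{_}}) ([m+n]-m≡n q (s + e * ϕ)))
    (cong +_ (quotient (φ N) {{φ[p^a]-nonZero p (suc a)}} φ≡ϕ))
    where
    quotient : ∀ d .{{_ : NonZero d}} → d ≡ ϕ → (s + e * ϕ) ℕ./ d ≡ e
    quotient d refl = [s+ed]/d≡e s e d s<ϕ

  fleckDegree≡ : ∀ {m} e s → m ≡ q + (s + e * ϕ) → s ℕ.< ϕ → s + suc (fleckDegree p (suc a) m) ≡ ϕ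
  fleckDegree≡ e s refl s<ϕ = begin
    s + suc (fleckDegree p (suc a) (q + (s + e * ϕ)))
      ≡⟨ cong (λ i → s + suc ((i ℤ.%ℕ φ N) {{_}})) (m-1-[m+n]≡-[1+n] q (s + e * ϕ)) ⟩
    s + suc ((-[1+ s + e * ϕ ] ℤ.%ℕ φ N) {{φ[p^a]-nonZero p (suc a)}})
      ≡⟨ cong (λ d → s + suc d) (remainder (φ N) {{φ[p^a]-nonZero p (suc a)}} φ≡ϕ) ⟩
    s + suc (ϕ ∸ suc s) ≡⟨ ℕ.+-suc s (ϕ ∸ suc s) ⟩
    suc s + (ϕ ∸ suc s) ≡⟨ ℕ.m+[n∸m]≡n s<ϕ ⟩
    ϕ ∎
    where
    open ≡-Reasoning
    remainder : ∀ d .{{_ : NonZero d}} → d ≡ ϕ → -[1+ s + e * ϕ ] ℤ.%ℕ d ≡ ϕ ∸ suc s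
    remainder d refl = -[1+s+ed]%d s e d s<ϕ

  fleckQuotient≡value : ∀ {m} e s → m ≡ q + (s + e * ϕ) → s ℕ.< ϕ → ∀ r →
    fleckQuotient p (suc a) m r ≡ fromℤ (value e s r)
  fleckQuotient≡value {m} e s m≡ s<ϕ r = begin
    fleckQuotient p (suc a) m r
      ≡⟨ cong₂ (λ i b → neg^ p (ℤ.- i) ℚ.* fromℤ (altSum N m r) ℚ.+ (if b then 1ℚ else 0ℚ))
           (fleckExponent≡ e s m≡ s<ϕ)
           (dec-false (m ℕ.<? q) (ℕ.≤⇒≯ (subst (q ℕ.≤_) (sym m≡) (ℕ.m≤m+n q (s + e * ϕ))))) ⟩
    neg^ p (ℤ.- + e) ℚ.* fromℤ (altSum N m r) ℚ.+ 0ℚ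
      ≡⟨ ℚ.+-identityʳ _ ⟩
    neg^ p (ℤ.- + e) ℚ.* fromℤ (altSum N m r)
      ≡⟨ cong (λ i → neg^ p (ℤ.- + e) ℚ.* fromℤ i) (altSum≡[-p]^e*value e s m≡ r) ⟩
    neg^ p (ℤ.- + e) ℚ.* fromℤ ((ℤ.- + p) ℤ.^ e ℤ.* value e s r)
      ≡⟨ neg^-e*[-p]^e*z p e (value e s r) ⟩
    fromℤ (value e s r) ∎
    where open ≡-Reasoning

  value-Δ : ∀ e s r → value e (suc s) r ≡ value e s r ℤ.- value e s (r ℤ.- 1ℤ)
  value-Δ e s = act-y (y ↑ s ⊗ M e) (δ N)

  y^ϕ⊗M≈0 : ∀ e → y ↑ ϕ ⊗ M e Q.≈ con 0ℤ
  y^ϕ⊗M≈0 e = Q.≈-trans (Q.*-congʳ (Q.≈-sym (Powers.↑-* N p y q (suc n)))) (y^φ⊗M≈0 e)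

  value-expansion : ∀ e s L → s + L ≡ ϕ → ∀ r →
    value e s r ≡ sumℤ {L} (λ j → multichoose (toℕ j) r ℤ.* value e (s + toℕ j) 0ℤ) ⟨ p ⟩
  value-expansion e s L s+L≡ϕ r = subst (λ t → value e t r ≡ sumℤ {L} (λ j → multichoose (toℕ j) r ℤ.* value e (s + toℕ j) 0ℤ) ⟨ p ⟩)
    (ℕ.+-identityʳ s)
    (newton p (λ j → value e (s + j))
      (λ j r → trans (cong (λ t → value e t r) (ℕ.+-suc s j)) (value-Δ e (s + j) r)) L
      (λ r → subst (λ t → value e t r ≡ 0ℤ ⟨ p ⟩) (sym s+L≡ϕ)
        (⟨⟩-trans {i = value e ϕ r} {act (con 0ℤ) (δ N) r} {0ℤ} (Q.at (y^ϕ⊗M≈0 e) r) (⟨⟩-reflexive (ℤ.*-zeroˡ (δ N r))))) r)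

  module _ {s} (s<ϕ : s ℕ.< ϕ) where
    private
      -- Since N = q + ϕ, this `k` makes v y^q the power y^(N-1), the last one whose constant
      -- coefficient is seen without wrapping; a further factor y^q with q ≥ 1 gives a multiple of
      -- y^N = 0.
      k = ϕ ∸ suc s
      v = y ↑ k ⊗ y ↑ s
      T = k + s + q
    open Powers N p
    open ≈-Reasoning Q.setoid

    N≡1+T : N ≡ suc T
    N≡1+T = trans (ℕ.+-comm q (suc n * q)) (cong (_+ q)
      (trans (ℕ.*-comm (suc n) q) (trans (sym (ℕ.m∸n+n≡m s<ϕ)) (ℕ.+-suc k s))))

    v⊗y^q≈ : v ⊗ y ↑ q Q.≈ y ↑ T
    v⊗y^q≈ = Q.≈-sym (Q.≈-trans (↑-distribˡ-+ y (k + s) q) (Q.*-congʳ (↑-distribˡ-+ y k s)))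

    v⊗y^q⊗y^q≈0 : v ⊗ y ↑ q ⊗ y ↑ q Q.≈ con 0ℤ
    v⊗y^q⊗y^q≈0 = begin
      v ⊗ y ↑ q ⊗ y ↑ q     ≈⟨ Q.*-congʳ v⊗y^q≈ ⟩
      y ↑ T ⊗ y ↑ q         ≈⟨ ↑-distribˡ-+ y T q ⟨
      y ↑ (T + q)           ≈⟨ Q.≈-reflexive (cong (y ↑_) exponent) ⟩
      y ↑ (N + (q ∸ 1))     ≈⟨ ↑-distribˡ-+ y N (q ∸ 1) ⟩
      y ↑ N ⊗ y ↑ (q ∸ 1)   ≈⟨ Q.*-congʳ (y^p^a≈0 n p-prime (suc a)) ⟩
      con 0ℤ ⊗ y ↑ (q ∸ 1)  ≈⟨ solve 1 (λ u → :con 0ℤ :* u := :con 0ℤ) Q.≈-refl (y ↑ (q ∸ 1)) ⟩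
      con 0ℤ ∎
      where
      open Q.Solver renaming (con to :con) using (solve; _:=_; _:*_)
      exponent : T + q ≡ N + (q ∸ 1)
      exponent = trans (cong (λ i → T + i) (sym (ℕ.suc-pred q)))
        (trans (ℕ.+-suc T (ℕ.pred q)) (cong (_+ (q ∸ 1)) (sym N≡1+T)))

    act-y^T≡1 : act (y ↑ T) (δ N) 0ℤ ≡ 1ℤ
    act-y^T≡1 = trans (cong (λ m → act (y ↑ T) (δ m) 0ℤ) N≡1+T) (act-y^[N-1] T)

    value-nonzero : ∀ e → ∃[ r ] ¬ + p ∣ value e s r
    value-nonzero e = act-nonzero p (y ↑ k ⊗ u) (value e s) 0ℤ λ p∣i →
      ℕ.>⇒∤ (ℕ.s≤s (ℕ.s≤s ℕ.z≤n)) (ℤ.∣⇒∣ᵤ (subst (+ p ∣_) (trans (cancel i (act (y ↑ T) (δ N) 0ℤ)) act-y^T≡1)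
        (ℤ.∣m∣n⇒∣m-n p∣i (Q.at y^k⊗u⊗y^s⊗M≈ 0ℤ))))
      where
      open Q.Solver using (solve; _:=_; _:*_)
      u = proj₁ (M∣y^q e)
      i = act (y ↑ k ⊗ u) (value e s) 0ℤ
      cancel : ∀ i j → i ℤ.- (i ℤ.- j) ≡ j
      cancel = solve-∀
      y^k⊗u⊗y^s⊗M≈ : y ↑ k ⊗ u ⊗ (y ↑ s ⊗ M e) Q.≈ y ↑ T
      y^k⊗u⊗y^s⊗M≈ = begin
        y ↑ k ⊗ u ⊗ (y ↑ s ⊗ M e) ≈⟨ solve 4 (λ a u b m → a :* u :* (b :* m) := a :* b :* u :* m) Q.≈-refl (y ↑ k) u (y ↑ s) (M e) ⟩
        v ⊗ u ⊗ M e               ≈⟨ proj₂ (M∣y^q e) v v⊗y^q⊗y^q≈0 ⟩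
        v ⊗ y ↑ q                 ≈⟨ v⊗y^q≈ ⟩
        y ↑ T ∎

  -- For e = 0 the bound reads q ≤ s, so y^s supplies the factor Y under which M_p and M_0 agree.
  -- For positive e the sequence M itself is periodic.
  value-periodic : ∀ e s → q ℕ.≤ s + e * ϕ → ∀ r → value (e + p) s r ≡ value e s r ⟨ p ⟩
  value-periodic zero s q≤s = Q.at (begin
    y ↑ s ⊗ M p                     ≈⟨ split (M p) ⟩
    y ↑ (s ∸ q) ⊗ (y ↑ q ⊗ M p)     ≈⟨ Q.*-congˡ y^q⊗M[p]≈ ⟩
    y ↑ (s ∸ q) ⊗ (y ↑ q ⊗ M 0)     ≈⟨ split (M 0) ⟨
    y ↑ s ⊗ M 0 ∎)
    where
    open ≈-Reasoning Q.setoid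
    open Q.Solver using (solve; _:=_; _:*_)
    split : ∀ u → y ↑ s ⊗ u Q.≈ y ↑ (s ∸ q) ⊗ (y ↑ q ⊗ u)
    split u = begin
      y ↑ s ⊗ u                   ≈⟨ Q.*-congʳ (Q.≈-reflexive (cong (y ↑_) (ℕ.m∸n+n≡m (subst (q ℕ.≤_) (ℕ.+-identityʳ s) q≤s)))) ⟨
      y ↑ (s ∸ q + q) ⊗ u         ≈⟨ Q.*-congʳ (Powers.↑-distribˡ-+ N p y (s ∸ q) q) ⟩
      y ↑ (s ∸ q) ⊗ y ↑ q ⊗ u     ≈⟨ solve 3 (λ a b u → a :* b :* u := a :* (b :* u)) Q.≈-refl (y ↑ (s ∸ q)) (y ↑ q) u ⟩
      y ↑ (s ∸ q) ⊗ (y ↑ q ⊗ u) ∎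
  value-periodic (suc e) s _ = Q.at (Q.*-congˡ {y ↑ s} {M (suc e + p)} {M (suc e)}
    (Q.≈-trans (Q.≈-reflexive (cong (M ∘ suc) (ℕ.+-comm e p))) (M[1+p+e]≈ e)))

  isOrd : ∀ {m} e s → m ≡ q + (s + e * ϕ) → s ℕ.< ϕ → ∀ r → ¬ + p ∣ value e s r →
    IsOrd p (altSum N m r) (fleckExponent p (suc a) m)
  isOrd {m} e s m≡ s<ϕ r p∤value = e , fleckExponent≡ e s m≡ s<ϕ
    , ℤ.∣ᵤ⇒∣ (subst (p ^ e ℕ.∣_) (sym ∣altSum∣) (ℕ.m∣m*n ℤ.∣ value e s r ∣))
    , maximal
    where
    open ≡-Reasoning
    ∣[-p]^_∣ : ∀ e → ℤ.∣ (ℤ.- + p) ℤ.^ e ∣ ≡ p ^ e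
    ∣[-p]^ zero ∣  = refl
    ∣[-p]^ suc e ∣ = trans (ℤ.abs-* (ℤ.- + p) ((ℤ.- + p) ℤ.^ e)) (cong (p *_) ∣[-p]^ e ∣)
    ∣altSum∣ : ℤ.∣ altSum N m r ∣ ≡ p ^ e * ℤ.∣ value e s r ∣
    ∣altSum∣ = begin
      ℤ.∣ altSum N m r ∣                              ≡⟨ cong ℤ.∣_∣ (altSum≡[-p]^e*value e s m≡ r) ⟩
      ℤ.∣ (ℤ.- + p) ℤ.^ e ℤ.* value e s r ∣           ≡⟨ ℤ.abs-* ((ℤ.- + p) ℤ.^ e) (value e s r) ⟩
      ℤ.∣ (ℤ.- + p) ℤ.^ e ∣ * ℤ.∣ value e s r ∣       ≡⟨ cong (_* ℤ.∣ value e s r ∣) ∣[-p]^ e ∣ ⟩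
      p ^ e * ℤ.∣ value e s r ∣ ∎
    maximal : ∀ j → + (p ^ j) ∣ altSum N m r → j ℕ.≤ e
    maximal j p^j∣ = ℕ.≮⇒≥ λ e<j → p∤value (ℤ.∣ᵤ⇒∣ (ℕ.*-cancelˡ-∣ (p ^ e) {{ℕ.m^n≢0 p e}}
      (subst (ℕ._∣ p ^ e * ℤ.∣ value e s r ∣) (ℕ.*-comm p (p ^ e))
        (ℕ.∣-trans (p^1+e∣p^j e<j) (subst (p ^ j ℕ.∣_) ∣altSum∣ (ℤ.∣⇒∣ᵤ p^j∣))))))
      where
      p^1+e∣p^j : e ℕ.< j → p ^ suc e ℕ.∣ p ^ j
      p^1+e∣p^j e<j = subst (λ i → p ^ suc e ℕ.∣ p ^ i) (ℕ.m+[n∸m]≡n e<j)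
        (subst (p ^ suc e ℕ.∣_) (sym (ℕ.^-distribˡ-+-* p (suc e) (j ∸ suc e))) (ℕ.m∣m*n (p ^ (j ∸ suc e))))

theorem1p4 : ∀ (p a n : ℕ) .{{_ : NonZero p}} .{{_ : NonZero a}} .{{_ : NonZero n}} →
    Prime p → n ≥ p ^ (a ∸ 1) →
    let d = fleckDegree p a n in
    (∀ (r : ℤ) →
    fleckQuotient p a n r
    ≡ sumℚ {suc d} (λ k →
    binom (r ℤ.+ + toℕ k ℤ.- 1ℤ) (toℕ k) ℚ.* fleckQuotient p a (n + toℕ k) 0ℤ)
    [mod p ])
    × (∃[ r ]
    IsOrd p (altSum (p ^ a) n r) (fleckExponent p a n)
    × p ∤ℚ fleckQuotient p a n r)
    × (n ≥ 2 * p ^ (a ∸ 1) →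
    ∀ (r : ℤ) →
    fleckQuotient p a (n + p ^ a * (p ∸ 1)) r ≡ fleckQuotient p a n r [mod p ])
theorem1p4 0 _ _ p-prime = contradiction p-prime ¬prime[0]
theorem1p4 1 _ _ p-prime = contradiction p-prime ¬prime[1]
theorem1p4 p@(suc (suc n)) (suc a) m p-prime m≥q = expansion , nonzero , periodic
  where
  open Value n p-prime a
  q = p ℕ.^ a
  d = fleckDegree p (suc a) m
  instance
    ϕ≢0 : NonZero ϕ
    ϕ≢0 = ℕ.m*n≢0 q (suc n) {{ℕ.m^n≢0 p a}}
  e = (m ∸ q) ℕ./ ϕ
  s = (m ∸ q) ℕ.% ϕ
  s<ϕ : s ℕ.< ϕ
  s<ϕ = ℕ.m%n<n (m ∸ q) ϕ
  m≡ : m ≡ q + (s + e * ϕ)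
  m≡ = trans (sym (ℕ.m+[n∸m]≡n m≥q)) (cong (λ i → q + i) (ℕ.m≡m%n+[m/n]*n (m ∸ q) ϕ))
  s+1+d≡ϕ : s + suc d ≡ ϕ
  s+1+d≡ϕ = fleckDegree≡ e s m≡ s<ϕ

  expansion : ∀ r → fleckQuotient p (suc a) m r
    ≡ sumℚ {suc d} (λ k → binom (r ℤ.+ + toℕ k ℤ.- 1ℤ) (toℕ k) ℚ.* fleckQuotient p (suc a) (m + toℕ k) 0ℤ)
    [mod p ]
  expansion r = value e s r , _ , fleckQuotient≡value e s m≡ s<ϕ r
    , trans (∑ℚ.sum-cong-≗ {suc d} terms) (fromℤ-sum (suc d) (λ k → multichoose (toℕ k) r ℤ.* value e (s + toℕ k) 0ℤ))
    , value-expansion e s (suc d) s+1+d≡ϕ r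
    where
    terms : ∀ (k : Fin (suc d)) → binom (r ℤ.+ + toℕ k ℤ.- 1ℤ) (toℕ k) ℚ.* fleckQuotient p (suc a) (m + toℕ k) 0ℤ
      ≡ fromℤ (multichoose (toℕ k) r ℤ.* value e (s + toℕ k) 0ℤ)
    terms k = trans (cong₂ ℚ._*_ (binom-multichoose r (toℕ k)) (fleckQuotient≡value e (s + toℕ k) m+k≡ s+k<ϕ 0ℤ))
      (sym (fromℤ-* (multichoose (toℕ k) r) (value e (s + toℕ k) 0ℤ)))
      where
      -- For k ≤ d the index m + k stays in the block of m, so all the quotients in the sum share
      -- the exponent `e`; d + 1 steps would reach the next block.
      s+k<ϕ : s + toℕ k ℕ.< ϕ
      s+k<ϕ = subst (s + toℕ k ℕ.<_) s+1+d≡ϕ (ℕ.+-monoʳ-< s (toℕ<n k))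
      m+k≡ : m + toℕ k ≡ q + (s + toℕ k + e * ϕ)
      m+k≡ = trans (cong (_+ toℕ k) m≡) (eq q s (e * ϕ) (toℕ k))
        where
        eq : ∀ q s t k → q + (s + t) + k ≡ q + (s + k + t)
        eq = ℕ-solve-∀

  nonzero : ∃[ r ] IsOrd p (altSum (p ℕ.^ suc a) m r) (fleckExponent p (suc a) m) × p ∤ℚ fleckQuotient p (suc a) m r
  nonzero = let (r , p∤value) = value-nonzero s<ϕ e in
    r , isOrd e s m≡ s<ϕ r p∤value , value e s r , fleckQuotient≡value e s m≡ s<ϕ r , p∤value

  periodic : m ≥ 2 * q → ∀ r →
    fleckQuotient p (suc a) (m + p ℕ.^ suc a * suc n) r ≡ fleckQuotient p (suc a) m r [mod p ]
  periodic m≥2q r = value (e + p) s r , value e s r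
    , fleckQuotient≡value (e + p) s m+≡ s<ϕ r , fleckQuotient≡value e s m≡ s<ϕ r
    , value-periodic e s q≤s+eϕ r
    where
    -- The shift p q (p - 1) equals p ϕ: it moves `e` by p and leaves `s` unchanged.
    m+≡ : m + p * q * suc n ≡ q + (s + (e + p) * ϕ)
    m+≡ = trans (cong (_+ p * q * suc n) m≡) (eq q s e p (suc n))
      where
      eq : ∀ q s e p k → q + (s + e * (q * k)) + p * q * k ≡ q + (s + (e + p) * (q * k))
      eq = ℕ-solve-∀
    q≤s+eϕ : q ℕ.≤ s + e * ϕ
    q≤s+eϕ = ℕ.+-cancelˡ-≤ q _ _ (subst (q + q ℕ.≤_) m≡ (subst (λ i → q + i ℕ.≤ m) (ℕ.+-identityʳ q) m≥2q))
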